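{- For every integer $r\ge 3$, $M(3r-4,r)\ge \frac53-\frac{1}{r-2}$.
   Context: The 2-density of a graph $H$ is $m_2(H)=\max\{\frac{e(H')-1}{|H'|-2}: H'\subseteq H,\ |H'|\ge 3\}$. $M(m,r)$ is the minimum of $m_2(H)$ over all graphs $H$ on $m$ vertices with independence number $\alpha(H)\le r-1$. -}

module Defs where

open import Data.Nat using (ℕ; zero; suc; _≤_)
open import Data.Bool using (Bool; true; false; if_then_else_; _∧_)
open import Data.Fin using (Fin; _<?_)
open import Data.Fin.Subset using (Subset; _∈_; ∣_∣)
open import Data.List using (List; map; allFin)
open import Data.Nat.ListAction using (sum)
open import Data.Product using (_×_; ∃)
open import Data.Integer as ℤ using (ℤ; +_)
open import Data.Rational as ℚ using (ℚ; 0ℚ)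
open import Relation.Nullary.Decidable using (⌊_⌋)
open import Relation.Binary.PropositionalEquality using (_≡_)

record Graph (n : ℕ) : Set where
  field
    adj   : Fin n → Fin n → Bool
    sym   : ∀ i j → adj i j ≡ adj j i
    irrefl : ∀ i → adj i i ≡ false
open Graph public

countEdges : {n : ℕ} → (Fin n → Fin n → Bool) → ℕ
countEdges {n} E =
  sum (map (λ i → sum (map (λ j → if ⌊ j <? i ⌋ ∧ E i j then 1 else 0) (allFin n))) (allFin n))

Independent : {n : ℕ} → Graph n → Subset n → Set
Independent G S = ∀ i j → i ∈ S → j ∈ S → adj G i j ≡ false

αAtMost : {n : ℕ} → Graph n → ℕ → Set
αAtMost {n} G k = (S : Subset n) → Independent G S → ∣ S ∣ ≤ k

record Subgraph {n : ℕ} (G : Graph n) : Set where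
  field
    verts    : Subset n
    edge     : Fin n → Fin n → Bool
    edge-sym : ∀ i j → edge i j ≡ edge j i
    edge-sub : ∀ i j → edge i j ≡ true → i ∈ verts × j ∈ verts × adj G i j ≡ true
open Subgraph public

vcount : {n : ℕ} {G : Graph n} → Subgraph G → ℕ
vcount H = ∣ verts H ∣

ecount : {n : ℕ} {G : Graph n} → Subgraph G → ℕ
ecount H = countEdges (edge H)

-- p ÷ d as a rational; convention p ÷ 0 = 0 (only used with d ≠ 0).
infixl 7 _÷_
_÷_ : ℤ → ℕ → ℚ
p ÷ zero = 0ℚ
p ÷ suc d = p ℚ./ suc d

ratio : {n : ℕ} {G : Graph n} → Subgraph G → ℚ
ratio H = (+ ecount H ℤ.- + 1) ÷ (vcount H Data.Nat.∸ 2)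

-- m₂(G) ≥ q : the maximum over subgraphs H' with |H'| ≥ 3 of ratio H' is ≥ q,
-- i.e. some such H' attains a ratio ≥ q.
m₂≥ : {n : ℕ} → Graph n → ℚ → Set
m₂≥ G q = ∃ λ (H : Subgraph G) → (3 ≤ vcount H) × (q ℚ.≤ ratio H)

M≥ : ℕ → ℕ → ℚ → Set
M≥ m r q = (G : Graph m) → αAtMost G (r Data.Nat.∸ 1) → m₂≥ G q

{-# OPTIONS --safe #-}
-- Put a = r - 1, so that G has 3a - 1 vertices. If 3e(U) + 8 > 5|U| for some U with |U| ≥ 3, then the
-- subgraph induced on U has ratio at least 5/3. Otherwise G is triangle-free, every vertex set W spans
-- a vertex of degree at most 3, and every W contains an independent set I such that, for some k ≥ 0,
--   4|W| ≤ e(W) + 7|I| + k   and   |W| + k ≤ 3|I|.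
-- For W = V(G), |I| ≤ a forces k ≤ 1 and then e(G) ≥ 5a - 5, which makes the ratio of G large enough.
-- The set I is built by induction on W, putting v into I and deleting v with its neighbours:
-- ∙ in degree at most 2 both inequalities survive, unless v and its neighbours have degree 2; then a
--   vertex of degree at most 1 arises, which lets k grow by one;
-- ∙ in degree 3 the second inequality drops by one, which a neighbour of degree at least 4 makes up for.
-- What is left is a connected cubic graph. If v lies on a 4-cycle, the opposite vertex has degree at most 1
-- after the deletion. Otherwise the remainder is 2-degenerate and without 4-cycles, and such a graph either
-- satisfies the second inequality with one to spare or has a component C₅. A component C₅ would send five
-- edges to the three neighbours of v, and two edges from a C₅ to one vertex create a triangle or a 4-cycle.
module Submission where

open import Defs renaming (sym to adj-sym; irrefl to adj-irrefl)
open import Data.Bool as Bool using (Bool; true; false; if_then_else_; _∧_)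
open import Data.Bool.Properties using (∧-zeroʳ; ¬-not)
open import Data.Empty using (⊥)
open import Data.Fin as Fin using (Fin; zero; suc)
open import Data.Fin.Patterns using (0F; 1F; 2F; 3F; 4F)
open import Data.Fin.Properties using (any?; all?; pigeonhole; <-cmp; <-asym; <⇒≢)
open import Data.Fin.Subset as Subset using (Subset; inside; outside; _∈_; _∉_; _⊆_; _∩_; _∪_; ⁅_⁆; ∁; ⊤; Empty; ∣_∣; Nonempty) renaming (_-_ to _∖_)
open import Data.Fin.Subset.Properties renaming (x∈p∧x≢y⇒x∈p-y to ∈-remove⁺)
open import Data.List as List using (List; []; _∷_; length; _++_; map; allFin)
open import Data.Nat.ListAction using (sum)
open import Data.List.Properties using (length-++; map-tabulate)
open import Data.List.Relation.Unary.All as All using (All; []; _∷_)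
import Data.List.Relation.Unary.All.Properties as All
open import Data.List.Relation.Unary.AllPairs using (AllPairs; []; _∷_)
import Data.List.Relation.Unary.AllPairs.Properties as AllPairs
open import Data.Nat using (ℕ; zero; suc; _+_; _*_; _∸_; _≤_; _<_; _≤?_; z≤n; s≤s; _≟_)
open import Data.Nat.Properties using (+-comm; +-assoc; +-identityʳ; suc-injective; +-mono-≤; +-monoˡ-≤; +-monoʳ-≤; ≤-refl; ≤-trans; ≤-reflexive; ≤-antisym; ≤-pred; m≤m+n; m≤n+m; +-cancelʳ-≤; ≰⇒>; <⇒≱; n≮n; ≤∧≢⇒<; n≤1+n; *-monoʳ-≤; *-monoˡ-≤; *-assoc; *-cancelˡ-≤; *-cancelˡ-<; m+n∸m≡n; *-zeroʳ; *-suc; <-≤-trans; module ≤-Reasoning)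
open import Data.Nat.Tactic.RingSolver using (solve-∀)
open import Data.Product using (_×_; _,_; proj₁; proj₂; ∃; ∃₂)
open import Data.Sum using (_⊎_; inj₁; inj₂)
open import Data.Vec using ([]; _∷_; here; there; tabulate; lookup)
open import Data.Vec.Properties using (lookup∘tabulate; lookup⇒[]=; []=⇒lookup)
open import Function using (_∘_)
open import Relation.Binary.Definitions using (tri<; tri≈; tri>)
open import Relation.Nullary using (¬_; Dec; yes; no; does; contradiction)
open import Relation.Nullary.Decidable using (_×-dec_; _→-dec_; _⊎-dec_; ¬?; decidable-stable; ⌊_⌋; map′; dec-true; True; toWitness)
open import Relation.Binary.PropositionalEquality using (_≡_; _≢_; refl; sym; trans; cong; cong₂; subst; subst₂; ≢-sym; module ≡-Reasoning)

private
  variable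
    n : ℕ

-- Weighted sums over finite sets of vertices.

⟦_⟧ : Bool → ℕ
⟦ b ⟧ = if b then 1 else 0

weight : Subset n → (Fin n → ℕ) → ℕ
weight []            f = 0
weight (inside  ∷ W) f = f zero + weight W (f ∘ suc)
weight (outside ∷ W) f = weight W (f ∘ suc)

weight-cong : ∀ (W : Subset n) {f g} → (∀ {i} → i ∈ W → f i ≡ g i) → weight W f ≡ weight W g
weight-cong []            eq = refl
weight-cong (inside  ∷ W) eq = cong₂ _+_ (eq here) (weight-cong W (eq ∘ there))
weight-cong (outside ∷ W) eq = weight-cong W (eq ∘ there)

weight-mono : ∀ {W : Subset n} {f g} → (∀ {i} → i ∈ W → f i ≤ g i) → weight W f ≤ weight W g
weight-mono {W = []}          le = z≤n
weight-mono {W = inside  ∷ W} le = +-mono-≤ (le here) (weight-mono (le ∘ there))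
weight-mono {W = outside ∷ W} le = weight-mono (le ∘ there)

weight-+ : ∀ (W : Subset n) f g → weight W (λ i → f i + g i) ≡ weight W f + weight W g
weight-+ []            f g = refl
weight-+ (inside  ∷ W) f g =
  trans (cong (f zero + g zero +_) (weight-+ W (f ∘ suc) (g ∘ suc))) (middle (f zero) (g zero) _ _)
  where
  middle : ∀ a b c d → a + b + (c + d) ≡ a + c + (b + d)
  middle = solve-∀
weight-+ (outside ∷ W) f g = weight-+ W (f ∘ suc) (g ∘ suc)

weight-const : ∀ (W : Subset n) k → weight W (λ _ → k) ≡ k * ∣ W ∣
weight-const []            k = sym (*-zeroʳ k)
weight-const (inside  ∷ W) k = trans (cong (k +_) (weight-const W k)) (sym (*-suc k ∣ W ∣))
weight-const (outside ∷ W) k = weight-const W k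

weight-remove : ∀ {W : Subset n} {x} f → x ∈ W → weight W f ≡ f x + weight (W ∖ x) f
weight-remove {W = inside ∷ W} f here = cong (λ V → f zero + weight V (f ∘ suc)) (sym (p─⊥≡p W))
weight-remove {W = inside ∷ W} {suc x} f (there x∈W) =
  trans (cong (f zero +_) (weight-remove (f ∘ suc) x∈W)) (swap (f zero) (f (suc x)) _)
  where
  swap : ∀ a b c → a + (b + c) ≡ b + (a + c)
  swap = solve-∀
weight-remove {W = outside ∷ W} f (there x∈W) = weight-remove (f ∘ suc) x∈W

weight-split : ∀ {S W : Subset n} f → S ⊆ W → weight W f ≡ weight S f + weight (W ∩ ∁ S) f
weight-split {S = []}          {[]}          f S⊆W = refl
weight-split {S = inside ∷ S}  {inside ∷ W}  f S⊆W =
  trans (cong (f zero +_) (weight-split (f ∘ suc) (drop-∷-⊆ S⊆W))) (sym (+-assoc (f zero) _ _))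
weight-split {S = inside ∷ S}  {outside ∷ W} f S⊆W = contradiction (S⊆W here) λ ()
weight-split {S = outside ∷ S} {inside ∷ W}  f S⊆W =
  trans (cong (f zero +_) (weight-split (f ∘ suc) (drop-∷-⊆ S⊆W))) (swap (f zero) (weight S (f ∘ suc)) _)
  where
  swap : ∀ a b c → a + (b + c) ≡ b + (a + c)
  swap = solve-∀
weight-split {S = outside ∷ S} {outside ∷ W} f S⊆W = weight-split (f ∘ suc) (drop-∷-⊆ S⊆W)

weight-⊆ : ∀ {S W : Subset n} f → S ⊆ W → weight S f ≤ weight W f
weight-⊆ {S = S} f S⊆W = subst (weight S f ≤_) (sym (weight-split f S⊆W)) (m≤m+n _ _)

∣∣-weight : ∀ (W : Subset n) → ∣ W ∣ ≡ weight W (λ _ → 1)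
∣∣-weight W = trans (sym (+-identityʳ _)) (sym (weight-const W 1))

∣∣-remove : ∀ {W : Subset n} {x} → x ∈ W → ∣ W ∣ ≡ suc ∣ W ∖ x ∣
∣∣-remove {W = W} {x} x∈W = begin
  ∣ W ∣                             ≡⟨ ∣∣-weight W ⟩
  weight W (λ _ → 1)                ≡⟨ weight-remove (λ _ → 1) x∈W ⟩
  suc (weight (W ∖ x) (λ _ → 1))    ≡⟨ cong suc (∣∣-weight (W ∖ x)) ⟨
  suc ∣ W ∖ x ∣                     ∎
  where open ≡-Reasoning

∣∣-split : ∀ {S W : Subset n} → S ⊆ W → ∣ W ∣ ≡ ∣ S ∣ + ∣ W ∩ ∁ S ∣
∣∣-split {S = S} {W} S⊆W = trans (∣∣-weight W)
  (trans (weight-split _ S⊆W) (sym (cong₂ _+_ (∣∣-weight S) (∣∣-weight (W ∩ ∁ S)))))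

∣∣-nonempty : ∀ {W : Subset n} → Nonempty W → 1 ≤ ∣ W ∣
∣∣-nonempty (x , x∈W) = subst (1 ≤_) (sym (∣∣-remove x∈W)) (s≤s z≤n)

∉-remove : ∀ {W : Subset n} {x} → x ∉ W ∖ x
∉-remove {W = _ ∷ _}       {suc x} (there x∈) = ∉-remove x∈
∉-remove {W = inside ∷ _}  {zero}  ()
∉-remove {W = outside ∷ _} {zero}  ()

∈-remove⁻ : ∀ {W : Subset n} {x y} → x ∈ W ∖ y → x ∈ W × x ≢ y
∈-remove⁻ {W = W} x∈ = p─q⊆p W _ x∈ , λ { refl → ∉-remove {W = W} x∈ }

remove-⊆ : ∀ {W : Subset n} {y} → W ∖ y ⊆ W
remove-⊆ = proj₁ ∘ ∈-remove⁻

-- A certificate for linear arithmetic: `l ≤ r` is a sum of known inequalities, `s` is the slack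
-- given away, and the remaining equation is an identity for the ring solver.
lin : ∀ {l r} L R s → l ≤ r → L + s + r ≡ R + l → L ≤ R
lin {l} {r} L R s l≤r eq = +-cancelʳ-≤ r L R (begin
  L + r       ≤⟨ +-monoˡ-≤ r (m≤m+n L s) ⟩
  L + s + r   ≡⟨ eq ⟩
  R + l       ≤⟨ +-monoʳ-≤ R l≤r ⟩
  R + r       ∎)
  where open ≤-Reasoning

weight-positive : ∀ {W : Subset n} {f} → 1 ≤ weight W f → ∃ λ x → x ∈ W × 1 ≤ f x
weight-positive {W = inside ∷ W} {f} 1≤ with f zero in eq
... | suc _ = zero , here , subst (1 ≤_) (sym eq) (s≤s z≤n)
... | zero with x , x∈W , 1≤fx ← weight-positive {W = W} 1≤ = suc x , there x∈W , 1≤fx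
weight-positive {W = outside ∷ W} 1≤ with x , x∈W , 1≤fx ← weight-positive {W = W} 1≤ =
  suc x , there x∈W , 1≤fx

-- Degrees, edge counts and independent sets.

module Neighbours {n : ℕ} (G : Graph n) where

  infix 4 _~_ _~?_

  _~_ : Fin n → Fin n → Set
  x ~ y = adj G x y ≡ true

  _~?_ : ∀ x y → Dec (x ~ y)
  x ~? y = adj G x y Bool.≟ true

  ~-sym : ∀ {x y} → x ~ y → y ~ x
  ~-sym {x} {y} x~y = trans (adj-sym G y x) x~y

  ~-irrefl : ∀ {x} → ¬ x ~ x
  ~-irrefl {x} x~x = contradiction (trans (sym x~x) (adj-irrefl G x)) λ ()

  ~⇒≢ : ∀ {x y} → x ~ y → x ≢ y
  ~⇒≢ x~x refl = ~-irrefl x~x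

  ≁⇒⟦⟧≡0 : ∀ {x y} → ¬ x ~ y → ⟦ adj G x y ⟧ ≡ 0
  ≁⇒⟦⟧≡0 {x} {y} x≁y with adj G x y
  ... | true  = contradiction refl x≁y
  ... | false = refl

  degree : Subset n → Fin n → ℕ
  degree W x = weight W (λ y → ⟦ adj G x y ⟧)

  degree-~ : ∀ {W x y} → y ∈ W → x ~ y → degree W x ≡ suc (degree (W ∖ y) x)
  degree-~ {W} {x} {y} y∈W x~y = trans (weight-remove _ y∈W) (cong (λ b → ⟦ b ⟧ + degree (W ∖ y) x) x~y)

  degree-≁ : ∀ {W x y} → y ∈ W → ¬ x ~ y → degree W x ≡ degree (W ∖ y) x
  degree-≁ {W} {x} {y} y∈W x≁y = trans (weight-remove _ y∈W) (cong (_+ degree (W ∖ y) x) (≁⇒⟦⟧≡0 x≁y))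

  degree-self : ∀ {W x} → x ∈ W → degree W x ≡ degree (W ∖ x) x
  degree-self x∈W = degree-≁ x∈W ~-irrefl

  degree-⊆ : ∀ {S W} x → S ⊆ W → degree S x ≤ degree W x
  degree-⊆ x S⊆W = weight-⊆ _ S⊆W

  degree-remove : ∀ W y x → degree (W ∖ y) x ≤ degree W x
  degree-remove W y x = degree-⊆ {W ∖ y} {W} x remove-⊆

  degree-positive : ∀ {W x y} → y ∈ W → x ~ y → 1 ≤ degree W x
  degree-positive y∈W x~y = subst (1 ≤_) (sym (degree-~ y∈W x~y)) (s≤s z≤n)

  degree≡0⇒≁ : ∀ {W x y} → degree W x ≡ 0 → y ∈ W → ¬ x ~ y
  degree≡0⇒≁ d≡0 y∈W x~y = n≮n 0 (subst (1 ≤_) d≡0 (degree-positive y∈W x~y))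

  neighbour : ∀ {W x} → 1 ≤ degree W x → ∃ λ y → y ∈ W × x ~ y
  neighbour {W} {x} 1≤d with y , y∈W , 1≤ ← weight-positive {W = W} 1≤d = y , y∈W , positive y 1≤
    where
    positive : ∀ y → 1 ≤ ⟦ adj G x y ⟧ → x ~ y
    positive y 1≤ with adj G x y
    ... | true = refl

  degree≤∣∣ : ∀ W x → degree W x ≤ ∣ W ∣
  degree≤∣∣ W x = subst (degree W x ≤_) (sym (∣∣-weight W)) (weight-mono {W = W} λ {y} _ → bound (adj G x y))
    where
    bound : ∀ b → ⟦ b ⟧ ≤ 1
    bound true  = s≤s z≤n
    bound false = z≤n

  -- Twice the number of edges spanned by W.
  degreeSum : Subset n → ℕ
  degreeSum W = weight W (degree W)

  -- Each edge at `x` is counted twice, once in the row of `x` and once in the row of its other end;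
  -- symmetry of `adj` makes the two contributions equal.
  degreeSum-remove : ∀ {W x} → x ∈ W → degreeSum W ≡ 2 * degree W x + degreeSum (W ∖ x)
  degreeSum-remove {W} {x} x∈W = begin
    degreeSum W
      ≡⟨ weight-remove (degree W) x∈W ⟩
    degree W x + weight (W ∖ x) (degree W)
      ≡⟨ cong (degree W x +_) (weight-cong (W ∖ x) λ _ → weight-remove _ x∈W) ⟩
    degree W x + weight (W ∖ x) (λ y → ⟦ adj G y x ⟧ + degree (W ∖ x) y)
      ≡⟨ cong (degree W x +_) (weight-+ (W ∖ x) _ _) ⟩
    degree W x + (weight (W ∖ x) (λ y → ⟦ adj G y x ⟧) + degreeSum (W ∖ x))
      ≡⟨ cong (λ d → degree W x + (d + degreeSum (W ∖ x))) (weight-cong (W ∖ x) λ {y} _ → cong ⟦_⟧ (adj-sym G y x)) ⟩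
    degree W x + (degree (W ∖ x) x + degreeSum (W ∖ x))
      ≡⟨ cong (λ d → degree W x + (d + degreeSum (W ∖ x))) (degree-self x∈W) ⟨
    degree W x + (degree W x + degreeSum (W ∖ x))
      ≡⟨ double (degree W x) _ ⟩
    2 * degree W x + degreeSum (W ∖ x) ∎
    where
    open ≡-Reasoning
    double : ∀ a b → a + (a + b) ≡ 2 * a + b
    double = solve-∀

  -- A list makes adding a vertex a cons and a disjoint union a concatenation; `x ≢ y` in `pairwise`
  -- makes its length the size of a set.
  record IndependentIn (W : Subset n) (m : ℕ) : Set where
    constructor independent
    field
      members  : List (Fin n)
      size     : length members ≡ m
      inside-W : All (_∈ W) members
      pairwise : AllPairs (λ x y → x ≢ y × ¬ x ~ y) members

  insert : ∀ {W W′ v m} → W′ ⊆ W → v ∈ W → v ∉ W′ → degree W′ v ≡ 0 →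
           IndependentIn W′ m → IndependentIn W (suc m)
  insert {v = v} W′⊆W v∈W v∉W′ d≡0 (independent xs size xs∈W′ pairs) = independent
    (v ∷ xs) (cong suc size) (v∈W ∷ All.map W′⊆W xs∈W′)
    (All.map (λ x∈W′ → (λ { refl → v∉W′ x∈W′ }) , degree≡0⇒≁ d≡0 x∈W′) xs∈W′ ∷ pairs)

  insert₂ : ∀ {W W′ u v m} → W′ ⊆ W → u ∈ W → v ∈ W → u ∉ W′ → v ∉ W′ → u ≢ v → ¬ u ~ v →
            degree W′ u ≡ 0 → degree W′ v ≡ 0 → IndependentIn W′ m → IndependentIn W (2 + m)
  insert₂ {W′ = W′} W′⊆W u∈W v∈W u∉W′ v∉W′ u≢v u≁v du≡0 dv≡0 (independent xs size xs∈W′ pairs) = independent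
    (_ ∷ _ ∷ xs) (cong (2 +_) size) (u∈W ∷ v∈W ∷ All.map W′⊆W xs∈W′)
    (((u≢v , u≁v) ∷ apart u∉W′ du≡0) ∷ apart v∉W′ dv≡0 ∷ pairs)
    where
    apart : ∀ {w} → w ∉ W′ → degree W′ w ≡ 0 → All (λ x → w ≢ x × ¬ w ~ x) xs
    apart w∉W′ d≡0 = All.map (λ x∈W′ → (λ { refl → w∉W′ x∈W′ }) , degree≡0⇒≁ d≡0 x∈W′) xs∈W′

  join : ∀ {S T W k m} → S ⊆ W → T ⊆ W → (∀ {x y} → x ∈ S → y ∈ T → x ≢ y × ¬ x ~ y) →
         IndependentIn S k → IndependentIn T m → IndependentIn W (k + m)
  join S⊆W T⊆W apart (independent xs sizex xs∈S pairsx) (independent ys sizey ys∈T pairsy) = independent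
    (xs ++ ys) (trans (length-++ xs) (cong₂ _+_ sizex sizey))
    (All.++⁺ (All.map S⊆W xs∈S) (All.map T⊆W ys∈T))
    (AllPairs.++⁺ pairsx pairsy (All.map (λ x∈S → All.map (apart x∈S) ys∈T) xs∈S))

  -- W′ arises from W by deleting p vertices and, with them, at least q edges.
  record Peeling (W W′ : Subset n) (p q : ℕ) : Set where
    constructor peeling
    field
      shrinks : W′ ⊆ W
      removed : ∣ W ∣ ≡ p + ∣ W′ ∣
      loss    : 2 * q + degreeSum W′ ≤ degreeSum W
  open Peeling public

  infixr 5 _⨾_

  peel : ∀ {W x d} → x ∈ W → d ≤ degree W x → Peeling W (W ∖ x) 1 d
  peel {W} {x} {d} x∈W d≤ = peeling remove-⊆ (∣∣-remove x∈W)
    (≤-trans (+-monoˡ-≤ _ (*-monoʳ-≤ 2 d≤)) (≤-reflexive (sym (degreeSum-remove x∈W))))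

  _⨾_ : ∀ {W W′ W″ p p′ q q′} → Peeling W W′ p q → Peeling W′ W″ p′ q′ → Peeling W W″ (p + p′) (q + q′)
  _⨾_ {p = p} {p′} {q} {q′} (peeling sub card edges) (peeling sub′ card′ edges′) = peeling
    (sub ∘ sub′)
    (trans card (trans (cong (p +_) card′) (sym (+-assoc p p′ _))))
    (≤-trans (≤-trans (≤-reflexive (rearrange q q′ _)) (+-monoʳ-≤ (2 * q) edges′)) edges)
    where
    rearrange : ∀ a b c → 2 * (a + b) + c ≡ 2 * a + (2 * b + c)
    rearrange = solve-∀

  -- Reductions and the inductive invariant.

  record Reduction (W W′ : Subset n) (p q s : ℕ) : Set where
    constructor reduction
    field
      peels  : Peeling W W′ p q
      extend : ∀ {m} → IndependentIn W′ m → IndependentIn W (s + m)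
  open Reduction public

  infixr 5 _⨾ᵣ_

  _⨾ᵣ_ : ∀ {W W′ W″ p p′ q q′ s s′} →
         Reduction W W′ p q s → Reduction W′ W″ p′ q′ s′ → Reduction W W″ (p + p′) (q + q′) (s + s′)
  _⨾ᵣ_ {s = s} {s′} (reduction P e) (reduction P′ e′) =
    reduction (P ⨾ P′) (subst (IndependentIn _) (sym (+-assoc s s′ _)) ∘ e ∘ e′)

  -- A unit of k pays for a pentagon, where 4 * 5 = 5 + 7 * 2 + 1 and 5 + 1 = 3 * 2.
  -- Edges are counted twice in edgeBound.
  record Good (c : ℕ) (W : Subset n) : Set where
    constructor good
    field
      k m       : ℕ
      witness   : IndependentIn W m
      edgeBound : 8 * ∣ W ∣ ≤ degreeSum W + 14 * m + 2 * k
      sizeBound : ∣ W ∣ + k + c ≤ 3 * m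

  edges-step : ∀ {W W′ p q s m} k k′ → Reduction W W′ p q s →
               8 * ∣ W′ ∣ ≤ degreeSum W′ + 14 * m + 2 * k → 4 * p + k ≤ q + 7 * s + k′ →
               8 * ∣ W ∣ ≤ degreeSum W + 14 * (s + m) + 2 * k′
  edges-step {W} {W′} {p} {q} {s} {m} k k′ (reduction (peeling _ card loss) _) edges e =
    subst (λ w → 8 * w ≤ degreeSum W + 14 * (s + m) + 2 * k′) (sym card)
      (lin (8 * (p + ∣ W′ ∣)) (degreeSum W + 14 * (s + m) + 2 * k′) 0 (+-mono-≤ (+-mono-≤ edges loss) (*-monoʳ-≤ 2 e))
        (edge-id p q s ∣ W′ ∣ (degreeSum W) (degreeSum W′) m k k′))
    where
    edge-id : ∀ p q s w e e′ m k k′ →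
              8 * (p + w) + 0 + (e′ + 14 * m + 2 * k + e + 2 * (q + 7 * s + k′)) ≡
              e + 14 * (s + m) + 2 * k′ + (8 * w + (2 * q + e′) + 2 * (4 * p + k))
    edge-id = solve-∀

  -- The two numeric hypotheses are the increments of the two bounds in `Good`: `p` vertices and at
  -- least `q` edges go, `s` vertices join the independent set. The indices `c` and `c′` are the
  -- room to spare in the size bounds before and after.
  good-step : ∀ {W W′ p q s c c′} k′ → Reduction W W′ p q s → (g : Good c W′) →
              4 * p + Good.k g ≤ q + 7 * s + k′ → p + k′ + c′ ≤ 3 * s + Good.k g + c → Good c′ W
  good-step {W} {W′} {p} {q} {s} {c} {c′} k′ R (good k m I edges size) e t =
    good k′ (s + m) (extend R I) (edges-step k k′ R edges e)
      (subst (λ w → w + k′ + c′ ≤ 3 * (s + m)) (sym (removed (peels R)))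
        (lin (p + ∣ W′ ∣ + k′ + c′) (3 * (s + m)) 0 (+-mono-≤ size t) (size-id p s ∣ W′ ∣ k k′ c c′ m)))
    where
    size-id : ∀ p s w k k′ c c′ m →
              p + w + k′ + c′ + 0 + (3 * m + (3 * s + k + c)) ≡ 3 * (s + m) + (w + k + c + (p + k′ + c′))
    size-id = solve-∀

  -- The exponents ⁰, ⁺ and ⁻ tell whether k is kept, raised or lowered by one.
  good-step⁰ : ∀ {W W′ p q s c c′} → Reduction W W′ p q s →
               {True (4 * p ≤? q + 7 * s)} → {True (p + c′ ≤? 3 * s + c)} → Good c W′ → Good c′ W
  good-step⁰ {p = p} {q} {s} {c} {c′} R {e} {t} g@(good k _ _ _ _) = good-step k R g
    (+-monoˡ-≤ k (toWitness e))
    (lin (p + k + c′) _ 0 (toWitness t) (id p s k c c′))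
    where
    id : ∀ p s k c c′ → p + k + c′ + 0 + (3 * s + c) ≡ 3 * s + k + c + (p + c′)
    id = solve-∀

  good-step⁺ : ∀ {W W′ p q s c c′} → Reduction W W′ p q s →
               {True (4 * p ≤? q + 7 * s + 1)} → {True (p + suc c′ ≤? 3 * s + c)} → Good c W′ → Good c′ W
  good-step⁺ {p = p} {q} {s} {c} {c′} R {e} {t} g@(good k _ _ _ _) = good-step (suc k) R g
    (lin (4 * p + k) _ 0 (toWitness e) (id₁ p q s k))
    (lin (p + suc k + c′) _ 0 (toWitness t) (id₂ p s k c c′))
    where
    id₁ : ∀ p q s k → 4 * p + k + 0 + (q + 7 * s + 1) ≡ q + 7 * s + suc k + 4 * p
    id₁ = solve-∀
    id₂ : ∀ p s k c c′ → p + suc k + c′ + 0 + (3 * s + c) ≡ 3 * s + k + c + (p + suc c′)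
    id₂ = solve-∀

  good-step⁻ : ∀ {W W′ p q s c c′} → Reduction W W′ p q s →
               {True (4 * p + 1 ≤? q + 7 * s)} → {True (p + c′ ≤? 3 * s + suc c)} →
               (∀ m → 8 * ∣ W ∣ ≤ degreeSum W + 14 * m → ∣ W ∣ + c′ ≤ 3 * m) →
               Good c W′ → Good c′ W
  -- Here `k` is already zero and cannot be lowered; the size bound is recovered from the edge bound
  -- by `slack`, that is, from sparsity.
  good-step⁻ {W} {p = p} {q} {s} {c′ = c′} R {e} slack (good zero m I edges _) =
    good zero (s + m) (extend R I) f≥0
      (subst (λ w → w + c′ ≤ 3 * (s + m)) (sym (+-identityʳ ∣ W ∣))
        (slack (s + m) (subst (8 * ∣ W ∣ ≤_) (+-identityʳ _) f≥0)))
    where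
    f≥0 = edges-step 0 0 R edges (+-monoˡ-≤ 0 (≤-trans (m≤m+n (4 * p) 1) (toWitness e)))
  good-step⁻ {p = p} {q} {s} {c} {c′} R {e} {t} slack g@(good (suc k) _ _ _ _) = good-step k R g
    (lin (4 * p + suc k) _ 0 (toWitness e) (id₁ p q s k))
    (lin (p + k + c′) _ 0 (toWitness t) (id₂ p s k c c′))
    where
    id₁ : ∀ p q s k → 4 * p + suc k + 0 + (q + 7 * s) ≡ q + 7 * s + k + (4 * p + 1)
    id₁ = solve-∀
    id₂ : ∀ p s k c c′ → p + k + c′ + 0 + (3 * s + suc c) ≡ 3 * s + suc k + c + (p + c′)
    id₂ = solve-∀

-- Triangle-freeness and deletions around a vertex.

module Sparse {n : ℕ} (G : Graph n)
  -- As `degreeSum` is twice the number of edges, this is 3e(U) + 8 ≤ 5|U| doubled: the ratio of `U`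
  -- stays strictly below 5/3.
  (sparse : ∀ U → 3 ≤ ∣ U ∣ → 3 * Neighbours.degreeSum G U + 16 ≤ 10 * ∣ U ∣) where

  open Neighbours G

  -- Three vertices with three edges would need 3 * 6 + 16 = 34 to be at most 10 * 3 = 30.
  triangle-free : ∀ {x y z} → x ~ y → x ~ z → ¬ y ~ z
  triangle-free {x} {y} {z} x~y x~z y~z = contradiction
    (lin 34 30 (3 * degreeSum V) (+-mono-≤ (+-mono-≤ (sparse U 3≤U) (*-monoʳ-≤ 3 (loss P))) (*-monoʳ-≤ 10 U≤3)) (id (degreeSum U) (degreeSum V) ∣ U ∣))
    (<⇒≱ (m≤m+n 31 3))
    where
    U V : Subset n
    U = ⁅ x ⁆ ∪ ⁅ y ⁆ ∪ ⁅ z ⁆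
    V = U ∖ x ∖ y ∖ z
    x∈U = x∈p∪q⁺ (inj₁ (x∈⁅x⁆ x))
    y∈U : y ∈ U
    y∈U = x∈p∪q⁺ (inj₂ (x∈p∪q⁺ (inj₁ (x∈⁅x⁆ y))))
    z∈U : z ∈ U
    z∈U = x∈p∪q⁺ (inj₂ (x∈p∪q⁺ (inj₂ (x∈⁅x⁆ z))))
    y∈U-x : y ∈ U ∖ x
    y∈U-x = ∈-remove⁺ y∈U (≢-sym (~⇒≢ x~y))
    z∈U-x : z ∈ U ∖ x
    z∈U-x = ∈-remove⁺ z∈U (≢-sym (~⇒≢ x~z))
    z∈U-x-y = ∈-remove⁺ z∈U-x (≢-sym (~⇒≢ y~z))
    2≤x : 2 ≤ degree U x
    2≤x = subst (2 ≤_) (sym (degree-~ y∈U x~y)) (s≤s (degree-positive (∈-remove⁺ z∈U (≢-sym (~⇒≢ y~z))) x~z))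
    P : Peeling U V 3 3
    P = peel x∈U 2≤x ⨾ peel y∈U-x (degree-positive z∈U-x y~z) ⨾ peel z∈U-x-y z≤n
    3≤U : 3 ≤ ∣ U ∣
    3≤U = subst (3 ≤_) (sym (removed P)) (m≤m+n 3 _)
    U≤3 : ∣ U ∣ ≤ 3
    U≤3 = ≤-reflexive (trans (removed P) (cong (3 +_) (trans (cong ∣_∣ (Empty-unique emptyV)) (∣⊥∣≡0 n))))
      where
      emptyV : Empty V
      emptyV (w , w∈V)
        with w∈U-x-y , w≢z ← ∈-remove⁻ w∈V
        with w∈U-x , w≢y ← ∈-remove⁻ w∈U-x-y
        with w∈U , w≢x ← ∈-remove⁻ w∈U-x
        with x∈p∪q⁻ ⁅ x ⁆ _ w∈U
      ... | inj₁ w∈x = w≢x (x∈⁅y⁆⇒x≡y x w∈x)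
      ... | inj₂ w∈yz with x∈p∪q⁻ ⁅ y ⁆ _ w∈yz
      ...   | inj₁ w∈y = w≢y (x∈⁅y⁆⇒x≡y y w∈y)
      ...   | inj₂ w∈z = w≢z (x∈⁅y⁆⇒x≡y z w∈z)
    id : ∀ u v c → 34 + 3 * v + (10 * c + 3 * u + 30) ≡ 30 + (3 * u + 16 + 3 * (6 + v) + 10 * c)
    id = solve-∀

  -- If it failed, then 3m ≤ |W|, and three times the edge bound would give 24|W| ≤ 3 `degreeSum W`
  -- + 42m ≤ (10|W| - 16) + 14|W|.
  slack : ∀ {W} → 3 ≤ ∣ W ∣ → ∀ m → 8 * ∣ W ∣ ≤ degreeSum W + 14 * m → ∣ W ∣ + 1 ≤ 3 * m
  slack {W} 3≤W m edges with ∣ W ∣ + 1 ≤? 3 * m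
  ... | yes bound = bound
  ... | no ¬bound = contradiction
    (lin 16 0 0 (+-mono-≤ (+-mono-≤ (*-monoʳ-≤ 3 edges) (sparse W 3≤W)) (*-monoʳ-≤ 14 (≰⇒> ¬bound)))
      (id ∣ W ∣ (degreeSum W) m))
    λ ()
    where
    id : ∀ w e m → 16 + 0 + (3 * (e + 14 * m) + 10 * w + 14 * (w + 1)) ≡
                   0 + (3 * (8 * w) + (3 * e + 16) + 14 * suc (3 * m))
    id = solve-∀

  slack₀ : ∀ {W} → 3 ≤ ∣ W ∣ → ∀ m → 8 * ∣ W ∣ ≤ degreeSum W + 14 * m → ∣ W ∣ + 0 ≤ 3 * m
  slack₀ {W} 3≤W m edges = ≤-trans (+-monoʳ-≤ ∣ W ∣ z≤n) (slack {W} 3≤W m edges)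

  record TwoNeighbours (W : Subset n) (v : Fin n) : Set where
    field
      {a b} : Fin n
      a∈W : a ∈ W
      b∈W : b ∈ W
      a≢b : a ≢ b
      v~a : v ~ a
      v~b : v ~ b

  record ThreeNeighbours (W : Subset n) (v : Fin n) : Set where
    field
      {a b c} : Fin n
      a∈W : a ∈ W
      b∈W : b ∈ W
      c∈W : c ∈ W
      a≢b : a ≢ b
      a≢c : a ≢ c
      b≢c : b ≢ c
      v~a : v ~ a
      v~b : v ~ b
      v~c : v ~ c

  degree-pred : ∀ {W v u d} → u ∈ W → v ~ u → degree W v ≡ suc d → degree (W ∖ u) v ≡ d
  degree-pred u∈W v~u deg = suc-injective (trans (sym (degree-~ u∈W v~u)) deg)

  neighbour-other : ∀ {W v u} → u ∈ W → v ~ u → 2 ≤ degree W v → ∃ λ w → w ∈ W × w ≢ u × v ~ w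
  neighbour-other {W} {v} {u} u∈W v~u 2≤d
    with w , w∈ , v~w ← neighbour {W ∖ u} {v} (≤-pred (subst (2 ≤_) (degree-~ u∈W v~u) 2≤d))
    with w∈W , w≢u ← ∈-remove⁻ w∈ = w , w∈W , w≢u , v~w

  twoNeighbours : ∀ {W v} → 2 ≤ degree W v → TwoNeighbours W v
  twoNeighbours 2≤d
    with a , a∈W , v~a ← neighbour (≤-trans (s≤s z≤n) 2≤d)
    with b , b∈W , b≢a , v~b ← neighbour-other a∈W v~a 2≤d =
    record { a∈W = a∈W ; b∈W = b∈W ; a≢b = ≢-sym b≢a ; v~a = v~a ; v~b = v~b }

  thirdNeighbour : ∀ {W v a b} → a ∈ W → b ∈ W → a ≢ b → v ~ a → v ~ b → degree W v ≡ 3 →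
                   ∃ λ c → c ∈ W × a ≢ c × b ≢ c × v ~ c
  thirdNeighbour {W} {v} {a} {b} a∈W b∈W a≢b v~a v~b deg
    with c , c∈ , v~c ← neighbour {W ∖ a ∖ b} {v} (≤-reflexive (sym
           (degree-pred (∈-remove⁺ b∈W (≢-sym a≢b)) v~b (degree-pred a∈W v~a deg))))
    with c∈W-a , c≢b ← ∈-remove⁻ c∈
    with c∈W , c≢a ← ∈-remove⁻ c∈W-a = c , c∈W , ≢-sym c≢a , ≢-sym c≢b , v~c

  isolated : ∀ {W v} → v ∈ W → degree W v ≡ 0 → Reduction W (W ∖ v) 1 0 1
  isolated v∈W deg = reduction (peel v∈W z≤n)
    (insert remove-⊆ v∈W ∉-remove (trans (sym (degree-self v∈W)) deg))

  pendant : ∀ {W v u d} → v ∈ W → u ∈ W → v ~ u → degree W v ≡ 1 → d ≤ degree W u →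
            Reduction W (W ∖ u ∖ v) 2 (d + 0) 1
  pendant {W} {v} {u} v∈W u∈W v~u deg d≤ = reduction P
    (insert (shrinks P) v∈W ∉-remove (trans (sym (degree-self v∈)) (degree-pred u∈W v~u deg)))
    where
    v∈ : v ∈ W ∖ u
    v∈ = ∈-remove⁺ v∈W (~⇒≢ v~u)
    P = peel u∈W d≤ ⨾ peel v∈ z≤n

  -- Two neighbours of `v` are not adjacent, so deleting one leaves the degree of the other alone.
  -- This is why the losses at the neighbours of `v` simply add up in `fork` and `claw`.
  degree-sibling : ∀ {W v a b} → a ∈ W → v ~ a → v ~ b → degree W b ≡ degree (W ∖ a) b
  degree-sibling a∈W v~a v~b = degree-≁ a∈W (triangle-free v~b v~a)

  -- The neighbours go first, so every edge at `v` is already counted in their degrees; `v` is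
  -- isolated by then and free to join the independent set.
  fork : ∀ {W v a b d e} → v ∈ W → a ∈ W → b ∈ W → a ≢ b → v ~ a → v ~ b → degree W v ≡ 2 →
         d ≤ degree W a → e ≤ degree W b → Reduction W (W ∖ a ∖ b ∖ v) 3 (d + (e + 0)) 1
  fork {W} {v} {a} {b} v∈W a∈W b∈W a≢b v~a v~b deg d≤ e≤ = reduction P
    (insert (shrinks P) v∈W ∉-remove (trans (sym (degree-self v∈))
      (degree-pred b∈ v~b (degree-pred a∈W v~a deg))))
    where
    b∈ : b ∈ W ∖ a
    b∈ = ∈-remove⁺ b∈W (≢-sym a≢b)
    v∈ : v ∈ W ∖ a ∖ b
    v∈ = ∈-remove⁺ (∈-remove⁺ v∈W (~⇒≢ v~a)) (~⇒≢ v~b)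
    P = peel a∈W d≤ ⨾ peel b∈ (subst (_ ≤_) (degree-sibling a∈W v~a v~b) e≤) ⨾ peel v∈ z≤n

  claw : ∀ {W v d e f} → v ∈ W → (N : ThreeNeighbours W v) → let open ThreeNeighbours N in degree W v ≡ 3 →
         d ≤ degree W a → e ≤ degree W b → f ≤ degree W c →
         Reduction W (W ∖ a ∖ b ∖ c ∖ v) 4 (d + (e + (f + 0))) 1
  claw {W} {v} v∈W N deg d≤ e≤ f≤ = reduction P
    (insert (shrinks P) v∈W ∉-remove (trans (sym (degree-self v∈))
      (degree-pred c∈ v~c (degree-pred b∈ v~b (degree-pred a∈W v~a deg)))))
    where
    open ThreeNeighbours N
    b∈ : b ∈ W ∖ a
    b∈ = ∈-remove⁺ b∈W (≢-sym a≢b)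
    c∈ : c ∈ W ∖ a ∖ b
    c∈ = ∈-remove⁺ (∈-remove⁺ c∈W (≢-sym a≢c)) (≢-sym b≢c)
    v∈ : v ∈ W ∖ a ∖ b ∖ c
    v∈ = ∈-remove⁺ (∈-remove⁺ (∈-remove⁺ v∈W (~⇒≢ v~a)) (~⇒≢ v~b)) (~⇒≢ v~c)
    P = peel a∈W d≤ ⨾ peel b∈ (subst (_ ≤_) (degree-sibling a∈W v~a v~b) e≤) ⨾
        peel c∈ (subst (_ ≤_) (trans (degree-sibling a∈W v~a v~c) (degree-sibling b∈ v~b v~c)) f≤) ⨾
        peel v∈ z≤n

  -- In both shapes at most two vertices are spent on one independent vertex, so the size bound
  -- gains at least one; the edge bound survives, in the second shape with equality, 4 * 2 = 1 + 7.
  data Leaf (W : Subset n) (v : Fin n) : Set where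
    leaf₀ : Reduction W (W ∖ v) 1 0 1 → Leaf W v
    leaf₁ : ∀ u → Reduction W (W ∖ u ∖ v) 2 1 1 → Leaf W v

  leaf : ∀ {W v} → v ∈ W → degree W v ≤ 1 → Leaf W v
  leaf {W} {v} v∈W d≤1 with degree W v in deg
  ... | zero = leaf₀ (isolated v∈W deg)
  ... | suc zero with u , u∈W , v~u ← neighbour {W} {v} (≤-reflexive (sym deg)) =
    leaf₁ u (pendant v∈W u∈W v~u deg (degree-positive v∈W (~-sym v~u)))
  leaf v∈W (s≤s ()) | suc (suc _)

-- Cyclic order on five indices.

next : Fin 5 → Fin 5
next 0F = 1F
next 1F = 2F
next 2F = 3F
next 3F = 4F
next 4F = 0F

rotate : ∀ {m} → Fin m → Fin 5 → Fin 5
rotate zero    i = i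
rotate (suc j) i = next (rotate j i)

next-rotate : ∀ (j i : Fin 5) → next (rotate j i) ≡ rotate (next j) i
next-rotate 0F i = refl
next-rotate 1F i = refl
next-rotate 2F i = refl
next-rotate 3F i = refl
-- The only case that relies on `next` having order five.
next-rotate 4F = toWitness {a? = all? λ i → next (rotate {5} 4F i) Fin.≟ i} _

data Position (i j : Fin 5) : Set where
  same      : i ≡ j → Position i j
  after     : j ≡ next i → Position i j
  before    : i ≡ next j → Position i j
  twoAfter  : j ≡ next (next i) → Position i j
  twoBefore : i ≡ next (next j) → Position i j

position : ∀ i j → Position i j
position i j = classify (toWitness {a? = all? λ i → all? λ j →
    (i Fin.≟ j) ⊎-dec (j Fin.≟ next i) ⊎-dec (i Fin.≟ next j) ⊎-dec (j Fin.≟ next (next i)) ⊎-dec (i Fin.≟ next (next j))} _ i j)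
  where
  classify : (i ≡ j) ⊎ (j ≡ next i) ⊎ (i ≡ next j) ⊎ (j ≡ next (next i)) ⊎ (i ≡ next (next j)) → Position i j
  classify (inj₁ p)                      = same p
  classify (inj₂ (inj₁ p))               = after p
  classify (inj₂ (inj₂ (inj₁ p)))        = before p
  classify (inj₂ (inj₂ (inj₂ (inj₁ p)))) = twoAfter p
  classify (inj₂ (inj₂ (inj₂ (inj₂ p)))) = twoBefore p

-- Cycles of length five.

module Pentagons {n : ℕ} (G : Graph n)
  (sparse : ∀ U → 3 ≤ ∣ U ∣ → 3 * Neighbours.degreeSum G U + 16 ≤ 10 * ∣ U ∣) where

  open Neighbours G
  open Sparse G sparse

  -- Adjacent vertices differ anyway, so `distinct` is only asked at distance two. Since there are
  -- no triangles, such a cycle is induced.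
  record Cycle₅ (W : Subset n) : Set where
    field
      c        : Fin 5 → Fin n
      c∈W      : ∀ i → c i ∈ W
      side     : ∀ i → c i ~ c (next i)
      distinct : ∀ i → c i ≢ c (next (next i))

    injective : ∀ {i j} → i ≢ j → c i ≢ c j
    injective {i} {j} i≢j with position i j
    ... | same i≡j       = contradiction i≡j i≢j
    ... | after refl     = ~⇒≢ (side i)
    ... | before refl    = ≢-sym (~⇒≢ (side j))
    ... | twoAfter refl  = distinct i
    ... | twoBefore refl = ≢-sym (distinct j)

    chordless : ∀ i → ¬ c i ~ c (next (next i))
    chordless i chord = triangle-free (side i) chord (side (next i))

  rotateCycle : ∀ {W} → Fin 5 → Cycle₅ W → Cycle₅ W
  rotateCycle i C = record
    { c        = λ j → c (rotate j i)
    ; c∈W      = λ j → c∈W (rotate j i)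
    ; side     = λ j → subst (λ k → c (rotate j i) ~ c k) (next-rotate j i) (side (rotate j i))
    ; distinct = λ j → subst (λ k → c (rotate j i) ≢ c k)
                   (trans (cong next (next-rotate j i)) (next-rotate (next j) i)) (distinct (rotate j i))
    }
    where open Cycle₅ C

  weaken : ∀ {S W} → S ⊆ W → Cycle₅ S → Cycle₅ W
  weaken S⊆W C = record { Cycle₅ C ; c∈W = S⊆W ∘ Cycle₅.c∈W C }

  FourCycleFree : Subset n → Set
  FourCycleFree W = ∀ {x y a b} → x ∈ W → y ∈ W → a ∈ W → b ∈ W → x ≢ y → a ≢ b →
                    x ~ a → x ~ b → y ~ a → ¬ y ~ b

  -- Two consecutive vertices of the cycle attached to `u` form a triangle with it; two at distance
  -- two form a 4-cycle with `u` and the cycle vertex between them.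
  attached-once : ∀ {W} → FourCycleFree W → (C : Cycle₅ W) → let open Cycle₅ C in
                  ∀ {u i j} → u ∈ W → (∀ k → c k ≢ u) → c i ~ u → c j ~ u → i ≡ j
  attached-once free C {u} {i} {j} u∈W c≢u i~u j~u with position i j
  ... | same i≡j       = i≡j
  ... | after refl     = contradiction (~-sym j~u) (λ u~j → triangle-free i~u (Cycle₅.side C i) u~j)
  ... | before refl    = contradiction (~-sym i~u) (λ u~i → triangle-free j~u (Cycle₅.side C j) u~i)
  ... | twoAfter refl  = contradiction (~-sym (side (next i)))
                           (free (c∈W i) (c∈W j) u∈W (c∈W (next i)) (distinct i) (≢-sym (c≢u _)) i~u (side i) j~u)
    where open Cycle₅ C
  ... | twoBefore refl = contradiction (~-sym (side (next j)))
                           (free (c∈W j) (c∈W i) u∈W (c∈W (next j)) (distinct j) (≢-sym (c≢u _)) j~u (side j) i~u)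
    where open Cycle₅ C

  -- The cycle already uses up degree 2, so no edge of `W` leaves it: the cycle is a component of
  -- `W`.
  record Pentagon (W : Subset n) : Set where
    field
      cycle    : Cycle₅ W
      degree≡2 : ∀ i → degree W (Cycle₅.c cycle i) ≡ 2

  rotatePentagon : ∀ {W} → Fin 5 → Pentagon W → Pentagon W
  rotatePentagon i K = record
    { cycle    = rotateCycle i (Pentagon.cycle K)
    ; degree≡2 = λ j → Pentagon.degree≡2 K (rotate j i)
    }

  -- The five sides and one further edge at `c 0F` give six edges. The two chosen vertices are at
  -- distance two and have no neighbours off the cycle, so both join the independent set. The edge
  -- bound is tight, 4 * 5 = 6 + 7 * 2, and the size bound gains one.
  removeCycle : ∀ {W} (C : Cycle₅ W) → let open Cycle₅ C in ∀ i →
                3 ≤ degree W (c 0F) → degree W (c i) ≡ 2 → degree W (c (next (next i))) ≡ 2 →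
                Reduction W (W ∖ c 0F ∖ c 1F ∖ c 2F ∖ c 3F ∖ c 4F) 5 6 2
  removeCycle {W} C i 3≤d₀ dᵢ dⱼ = reduction P
    (insert₂ (shrinks P) (c∈W i) (c∈W (next (next i))) (c∉ i) (c∉ (next (next i))) (distinct i) (chordless i)
      (cut i dᵢ) (cut (next (next i)) dⱼ))
    where
    open Cycle₅ C
    W₁ W₂ W₃ W₄ W₅ : Subset n
    W₁ = W ∖ c 0F
    W₂ = W₁ ∖ c 1F
    W₃ = W₂ ∖ c 2F
    W₄ = W₃ ∖ c 3F
    W₅ = W₄ ∖ c 4F
    ∈W₁ : ∀ i → 0F ≢ i → c i ∈ W₁
    ∈W₁ i 0≢i = ∈-remove⁺ (c∈W i) (injective (≢-sym 0≢i))
    ∈W₂ : ∀ i → 0F ≢ i → 1F ≢ i → c i ∈ W₂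
    ∈W₂ i 0≢i 1≢i = ∈-remove⁺ (∈W₁ i 0≢i) (injective (≢-sym 1≢i))
    3∈W₃ : c 3F ∈ W₃
    3∈W₃ = ∈-remove⁺ (∈W₂ 3F (λ ()) (λ ())) (injective λ ())
    4∈W₃ : c 4F ∈ W₃
    4∈W₃ = ∈-remove⁺ (∈W₂ 4F (λ ()) (λ ())) (injective λ ())
    4∈W₄ : c 4F ∈ W₄
    4∈W₄ = ∈-remove⁺ 4∈W₃ (injective λ ())
    P : Peeling W W₅ 5 6
    P = peel (c∈W 0F) 3≤d₀ ⨾
        peel (∈W₁ 1F λ ()) (degree-positive (∈W₁ 2F λ ()) (side 1F)) ⨾
        peel (∈W₂ 2F (λ ()) (λ ())) (degree-positive (∈W₂ 3F (λ ()) (λ ())) (side 2F)) ⨾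
        peel 3∈W₃ (degree-positive 4∈W₃ (side 3F)) ⨾
        peel 4∈W₄ z≤n
    ∈W₅⁻ : ∀ {x} → x ∈ W₅ → x ∈ W × (∀ i → x ≢ c i)
    ∈W₅⁻ x∈W₅
      with x∈W₄ , x≢4 ← ∈-remove⁻ x∈W₅
      with x∈W₃ , x≢3 ← ∈-remove⁻ x∈W₄
      with x∈W₂ , x≢2 ← ∈-remove⁻ x∈W₃
      with x∈W₁ , x≢1 ← ∈-remove⁻ x∈W₂
      with x∈W , x≢0 ← ∈-remove⁻ x∈W₁ =
      x∈W , λ { 0F → x≢0 ; 1F → x≢1 ; 2F → x≢2 ; 3F → x≢3 ; 4F → x≢4 }
    c∉ : ∀ i → c i ∉ W₅
    c∉ i i∈ = proj₂ (∈W₅⁻ i∈) i refl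
    cut : ∀ i → degree W (c i) ≡ 2 → degree W₅ (c i) ≡ 0
    -- The predecessor of `i` is `next` applied four times.
    cut i d = cut′ i (rotate {5} 4F i) (next-rotate 4F i) d
      where
      cut′ : ∀ i k → next k ≡ i → degree W (c i) ≡ 2 → degree W₅ (c i) ≡ 0
      cut′ i k refl d = ≤-antisym (≤-trans (degree-⊆ (c i) W₅⊆) (≤-reflexive
        (degree-pred next∈ (side i) (degree-pred (c∈W k) (~-sym (side k)) d)))) z≤n
        where
        next∈ : c (next i) ∈ W ∖ c k
        next∈ = ∈-remove⁺ (c∈W (next i)) (≢-sym (distinct k))
        W₅⊆ : W₅ ⊆ W ∖ c k ∖ c (next i)
        W₅⊆ x∈ with x∈W , x≢c ← ∈W₅⁻ x∈ = ∈-remove⁺ (∈-remove⁺ x∈W (x≢c k)) (x≢c (next i))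

-- Vertices of degree at most two.

module Reducing {n : ℕ} (G : Graph n)
  (sparse : ∀ U → 3 ≤ ∣ U ∣ → 3 * Neighbours.degreeSum G U + 16 ≤ 10 * ∣ U ∣)
  (M : ℕ) (smaller : ∀ U → ∣ U ∣ < M → Neighbours.Good G 0 U) where

  open Neighbours G
  open Sparse G sparse
  open Pentagons G sparse

  reduced : ∀ {W W′ p q s} → ∣ W ∣ ≤ M → Reduction W W′ (suc p) q s → Good 0 W′
  reduced {W} {W′} {p} W≤M R = smaller W′
    (<-≤-trans (subst (∣ W′ ∣ <_) (sym (removed (peels R))) (s≤s (m≤n+m _ p))) W≤M)

  at-least : ∀ {W W′ p q s} → Reduction W W′ (3 + p) q s → 3 ≤ ∣ W ∣
  at-least R = subst (3 ≤_) (sym (removed (peels R))) (m≤m+n 3 _)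

  good-leaf : ∀ {W v} → ∣ W ∣ ≤ M → v ∈ W → degree W v ≤ 1 → Good 1 W
  good-leaf W≤M v∈W d≤1 with leaf v∈W d≤1
  ... | leaf₀ R   = good-step⁰ R (reduced W≤M R)
  ... | leaf₁ _ R = good-step⁰ R (reduced W≤M R)

  good-weaken : ∀ {c W} → Good (suc c) W → Good c W
  good-weaken (good k m I edges size) = good k m I edges (≤-trans (+-monoʳ-≤ _ (n≤1+n _)) size)

  -- The neighbour u of a loses its neighbour a when the fork at v is removed.
  module _ {W : Subset n} {v a b u : Fin n} (a∈W : a ∈ W) (v~a : v ~ a) (v~b : v ~ b)
           (u∈W : u ∈ W) (u≢v : u ≢ v) (a~u : a ~ u) where

    beyond-fork : u ∈ W ∖ a ∖ b ∖ v
    beyond-fork = ∈-remove⁺ (∈-remove⁺ (∈-remove⁺ u∈W (≢-sym (~⇒≢ a~u)))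
                    λ { refl → triangle-free v~a v~b a~u }) u≢v

    degree-beyond-fork : ∀ {d} → degree W u ≤ suc d → degree (W ∖ a ∖ b ∖ v) u ≤ d
    degree-beyond-fork deg = ≤-trans (≤-trans (degree-remove (W ∖ a ∖ b) v u) (degree-remove (W ∖ a) b u))
      (≤-pred (subst (_≤ _) (degree-~ a∈W (~-sym a~u)) deg))

  -- A fork trades three vertices for one, which costs 4 * 3 - 7 = 5 edges, so one neighbour of
  -- degree at least 3 suffices. If `a` has degree 2, the fork is tried at `a`, with neighbours `v`
  -- and `u`. If `u` has degree 2 as well, the fork at `v` leaves `u` with degree at most 1, and the
  -- leaf step at `u` pays for raising `k`.
  good-degree≡2 : ∀ {W v} → ∣ W ∣ ≤ M → (∀ {x} → x ∈ W → 2 ≤ degree W x) → v ∈ W → degree W v ≡ 2 → Good 0 W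
  good-degree≡2 {W} {v} W≤M min v∈W deg with twoNeighbours {W} {v} (≤-reflexive (sym deg))
  ... | record { a = a ; b = b ; a∈W = a∈W ; b∈W = b∈W ; a≢b = a≢b ; v~a = v~a ; v~b = v~b }
    with 3 ≤? degree W a
  ... | yes 3≤a = good-step⁰ R (reduced W≤M R)
    where R = fork v∈W a∈W b∈W a≢b v~a v~b deg 3≤a (min b∈W)
  ... | no ¬3≤a with neighbour-other {W} {a} {v} v∈W (~-sym v~a) (min a∈W)
  ... | u , u∈W , u≢v , a~u with 3 ≤? degree W u
  ... | yes 3≤u = good-step⁰ R (reduced W≤M R)
    where R = fork a∈W v∈W u∈W (≢-sym u≢v) (~-sym v~a) a~u (≤-antisym (≤-pred (≰⇒> ¬3≤a)) (min a∈W)) (min v∈W) 3≤u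
  ... | no ¬3≤u
    with leaf (beyond-fork {b = b} a∈W v~a v~b u∈W u≢v a~u)
              (degree-beyond-fork {b = b} a∈W v~a v~b u∈W u≢v a~u (≤-pred (≰⇒> ¬3≤u)))
  ... | leaf₀ R = good-step⁺ S (reduced W≤M S)
    where S = fork v∈W a∈W b∈W a≢b v~a v~b deg (min a∈W) (min b∈W) ⨾ᵣ R
  ... | leaf₁ _ R = good-step⁺ S (reduced W≤M S)
    where S = fork v∈W a∈W b∈W a≢b v~a v~b deg (min a∈W) (min b∈W) ⨾ᵣ R

  -- Two-degenerate sets without 4-cycles.

  module _ {W₀ : Subset n} (free : FourCycleFree W₀) where

    module _ {W : Subset n} {x y z : Fin n} (W⊆W₀ : W ⊆ W₀) (W≤M : ∣ W ∣ ≤ M)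
             (x∈W : x ∈ W) (y∈W : y ∈ W) (z∈W : z ∈ W) (y≢z : y ≢ z) (x~y : x ~ y) (x~z : x ~ z)
             (deg : degree W x ≡ 2) where

      private
        z∈W-y : z ∈ W ∖ y
        z∈W-y = ∈-remove⁺ z∈W (≢-sym y≢z)
        x∈W-y-z : x ∈ W ∖ y ∖ z
        x∈W-y-z = ∈-remove⁺ (∈-remove⁺ x∈W (~⇒≢ x~y)) (~⇒≢ x~z)
        W″ : Subset n
        W″ = W ∖ y ∖ z ∖ x

      module _ {w : Fin n} (w∈W″ : w ∈ W″) where
        w≁x : ¬ w ~ x
        w≁x w~x = degree≡0⇒≁ (degree-pred z∈W-y x~z (degree-pred y∈W x~y deg)) (remove-⊆ w∈W″) (~-sym w~x)

        -- Of the three deleted vertices only `y` and `z` can be adjacent to `w`, because they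
        -- exhaust the degree of `x`.
        degree-quiet : ¬ w ~ y → ¬ w ~ z → degree W w ≡ degree W″ w
        degree-quiet w≁y w≁z = trans (degree-≁ y∈W w≁y) (trans (degree-≁ z∈W-y w≁z) (degree-≁ x∈W-y-z w≁x))

        degree-loud : w ~ y ⊎ w ~ z → degree W″ w < degree W w
        degree-loud (inj₁ w~y) = subst (degree W″ w <_) (sym (degree-~ y∈W w~y))
          (s≤s (≤-trans (degree-remove (W ∖ y ∖ z) x w) (degree-remove (W ∖ y) z w)))
        degree-loud (inj₂ w~z) = <-≤-trans
          (subst (degree W″ w <_) (sym (degree-~ z∈W-y w~z)) (s≤s (degree-remove (W ∖ y ∖ z) x w)))
          (degree-remove W y w)

      pentagon≢ : ∀ {w} → w ∈ W″ → w ≢ y × w ≢ z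
      pentagon≢ w∈W″
        with w∈ , _ ← ∈-remove⁻ w∈W″
        with w∈W-y , w≢z ← ∈-remove⁻ w∈
        with _ , w≢y ← ∈-remove⁻ w∈W-y = w≢y , w≢z

      -- Besides `c 0F`, which takes the only edge to `u`, at most one cycle vertex is attached to
      -- `t`. Among the pairs (1,3), (2,4) and (4,1) at distance two, one avoids it; its members
      -- still have degree 2 in `W`, as `removeCycle` requires.
      good-attached : ∀ {u t} (K : Pentagon W″) → let open Cycle₅ (Pentagon.cycle K) in
                      u ∈ W₀ → t ∈ W₀ → (∀ i → c i ≢ u) → (∀ i → c i ≢ t) →
                      (∀ {w} → w ∈ W″ → ¬ w ~ u → ¬ w ~ t → degree W w ≡ degree W″ w) →
                      3 ≤ degree W (c 0F) → c 0F ~ u → Good 1 W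
      good-attached {u} {t} K u∈W₀ t∈W₀ c≢u c≢t quiet 3≤d₀ 0~u = choose (c 1F ~? t) (c 3F ~? t)
        where
        open Pentagon K
        open Cycle₅ cycle
        W″⊆W : W″ ⊆ W
        W″⊆W = remove-⊆ ∘ remove-⊆ ∘ remove-⊆
        once : ∀ {v i j} → v ∈ W₀ → (∀ k → c k ≢ v) → c i ~ v → c j ~ v → i ≡ j
        once = attached-once free (weaken (W⊆W₀ ∘ W″⊆W) cycle)
        low : ∀ {i} → 0F ≢ i → ¬ c i ~ t → degree W (c i) ≡ 2
        low {i} 0≢i i≁t =
          trans (quiet (c∈W i) (λ i~u → 0≢i (once u∈W₀ c≢u 0~u i~u)) i≁t) (degree≡2 i)
        excluded : ∀ {i j} → c i ~ t → i ≢ j → ¬ c j ~ t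
        excluded i~t i≢j j~t = i≢j (once t∈W₀ c≢t i~t j~t)
        finish : ∀ i → degree W (c i) ≡ 2 → degree W (c (next (next i))) ≡ 2 → Good 1 W
        finish i dᵢ dⱼ = good-step⁰ R (reduced W≤M R)
          where R = removeCycle (weaken W″⊆W cycle) i 3≤d₀ dᵢ dⱼ
        choose : Dec (c 1F ~ t) → Dec (c 3F ~ t) → Good 1 W
        choose (yes 1~t) _         = finish 2F (low (λ ()) (excluded 1~t λ ())) (low (λ ()) (excluded 1~t λ ()))
        choose (no 1≁t)  (no 3≁t)  = finish 1F (low (λ ()) 1≁t) (low (λ ()) 3≁t)
        choose (no 1≁t)  (yes 3~t) = finish 4F (low (λ ()) (excluded 3~t λ ())) (low (λ ()) 1≁t)

      lift-pentagon : Pentagon W″ → Good 1 W ⊎ Pentagon W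
      lift-pentagon K with any? (λ i → (Cycle₅.c (Pentagon.cycle K) i ~? y) ⊎-dec (Cycle₅.c (Pentagon.cycle K) i ~? z))
      ... | no ¬attached = inj₂ record
        { cycle    = weaken (remove-⊆ ∘ remove-⊆ ∘ remove-⊆) cycle
        ; degree≡2 = λ i → trans (degree-quiet (c∈W i) (λ i~y → ¬attached (i , inj₁ i~y)) (λ i~z → ¬attached (i , inj₂ i~z)))
                             (degree≡2 i)
        }
        where
        open Pentagon K
        open Cycle₅ cycle
      ... | yes (i , attached) = inj₁ (by attached)
        where
        -- Rotation moves the attached vertex to index 0, where `good-attached` expects it.
        K′ = rotatePentagon i K
        open Cycle₅ (Pentagon.cycle K′)
        y∈W₀ = W⊆W₀ y∈W
        z∈W₀ = W⊆W₀ z∈W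
        c≢y : ∀ i → c i ≢ y
        c≢y i = proj₁ (pentagon≢ (c∈W i))
        c≢z : ∀ i → c i ≢ z
        c≢z i = proj₂ (pentagon≢ (c∈W i))
        3≤d₀ : c 0F ~ y ⊎ c 0F ~ z → 3 ≤ degree W (c 0F)
        3≤d₀ loud = subst (_< degree W (c 0F)) (Pentagon.degree≡2 K′ 0F) (degree-loud (c∈W 0F) loud)
        by : c 0F ~ y ⊎ c 0F ~ z → Good 1 W
        by (inj₁ 0~y) = good-attached K′ y∈W₀ z∈W₀ c≢y c≢z degree-quiet (3≤d₀ (inj₁ 0~y)) 0~y
        by (inj₂ 0~z) = good-attached K′ z∈W₀ y∈W₀ c≢z c≢y (λ w∈ w≁z w≁y → degree-quiet w∈ w≁y w≁z) (3≤d₀ (inj₂ 0~z)) 0~z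

    Degenerate : Subset n → Set
    Degenerate W = ∀ S → S ⊆ W → Nonempty S → ∃ λ x → x ∈ S × degree S x ≤ 2

    degenerate-⊆ : ∀ {S W} → S ⊆ W → Degenerate W → Degenerate S
    degenerate-⊆ S⊆W degenerate T T⊆S = degenerate T (S⊆W ∘ T⊆S)

    -- This needs an induction of its own, on `N`: the outer hypothesis `smaller` returns no room to
    -- spare, whereas one unit has to be carried along here.
    GoodOrPentagon : ℕ → Set
    GoodOrPentagon N = ∀ W → ∣ W ∣ < N → ∣ W ∣ ≤ M → W ⊆ W₀ → Degenerate W → Nonempty W → Good 1 W ⊎ Pentagon W

    module _ {N : ℕ} (induction : GoodOrPentagon N) {W : Subset n} (W≤N : ∣ W ∣ ≤ N) (W≤M : ∣ W ∣ ≤ M)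
             (W⊆W₀ : W ⊆ W₀) (degenerate : Degenerate W) (min : ∀ {x} → x ∈ W → 2 ≤ degree W x) where

      -- The fork at `x` removes five edges, 12 = 5 + 7, and three vertices for one, so the spare
      -- unit of the remainder is passed on unchanged. The second neighbour `u` of `y` shows that
      -- the remainder is nonempty.
      unbalanced : ∀ {x y z} → x ∈ W → y ∈ W → z ∈ W → y ≢ z → x ~ y → x ~ z →
                   degree W x ≡ 2 → degree W y ≡ 2 → 3 ≤ degree W z → Good 1 W ⊎ Pentagon W
      unbalanced {x} {y} {z} x∈W y∈W z∈W y≢z x~y x~z dx dy 3≤z
        with u , u∈W , u≢x , y~u ← neighbour-other x∈W (~-sym x~y) (min y∈W) =
        continue (induction (W ∖ y ∖ z ∖ x) W″<N (≤-trans (≤-trans (n≤1+n _) W″<W) W≤M) (W⊆W₀ ∘ shrinks (peels R))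
          (degenerate-⊆ (shrinks (peels R)) degenerate) (u , beyond-fork {b = z} y∈W x~y x~z u∈W u≢x y~u))
        where
        R : Reduction W (W ∖ y ∖ z ∖ x) 3 5 1
        R = fork x∈W y∈W z∈W y≢z x~y x~z dx (≤-reflexive (sym dy)) 3≤z
        W″<W : ∣ W ∖ y ∖ z ∖ x ∣ < ∣ W ∣
        W″<W = subst (∣ W ∖ y ∖ z ∖ x ∣ <_) (sym (removed (peels R))) (s≤s (m≤n+m _ 2))
        W″<N = <-≤-trans W″<W W≤N
        continue : Good 1 (W ∖ y ∖ z ∖ x) ⊎ Pentagon (W ∖ y ∖ z ∖ x) → Good 1 W ⊎ Pentagon W
        continue (inj₁ g) = inj₁ (good-step⁰ R g)
        continue (inj₂ K) = lift-pentagon W⊆W₀ W≤M x∈W y∈W z∈W y≢z x~y x~z dx K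

      -- With `u` of degree at least 3, `unbalanced` applies at `y`. Otherwise `u` has degree at
      -- most 1 after the fork. If it is isolated, or its neighbour `p` still has degree at least 2,
      -- deleting on from `u` gains the spare unit; if not, `x`, `y`, `u`, `p`, `z` close up to a
      -- pentagon.
      balanced : ∀ {x y z} → x ∈ W → y ∈ W → z ∈ W → y ≢ z → x ~ y → x ~ z →
                 degree W x ≡ 2 → degree W y ≡ 2 → degree W z ≡ 2 → Good 1 W ⊎ Pentagon W
      balanced {x} {y} {z} x∈W y∈W z∈W y≢z x~y x~z dx dy dz
        with neighbour-other x∈W (~-sym x~y) (min y∈W)
      ... | u , u∈W , u≢x , y~u with 3 ≤? degree W u
      ... | yes 3≤u = unbalanced y∈W x∈W u∈W (≢-sym u≢x) (~-sym x~y) y~u dy dx 3≤u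
      ... | no ¬3≤u = analyse (degree W″ u) refl
        where
        W″ : Subset n
        W″ = W ∖ y ∖ z ∖ x
        du = ≤-antisym (≤-pred (≰⇒> ¬3≤u)) (min u∈W)
        u∈W″ : u ∈ W″
        u∈W″ = beyond-fork {b = z} y∈W x~y x~z u∈W u≢x y~u
        du″ : degree W″ u ≤ 1
        du″ = degree-beyond-fork {b = z} y∈W x~y x~z u∈W u≢x y~u (≤-reflexive du)
        F : Reduction W W″ 3 4 1
        F = fork x∈W y∈W z∈W y≢z x~y x~z dx (≤-reflexive (sym dy)) (≤-reflexive (sym dz))
        close : ∀ {p} → p ∈ W″ → u ~ p → degree W″ p ≤ 1 → Pentagon W
        close {p} p∈W″ u~p dp″ = record
          { cycle = record
            { c        = λ { 0F → x ; 1F → y ; 2F → u ; 3F → p ; 4F → z }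
            ; c∈W      = λ { 0F → x∈W ; 1F → y∈W ; 2F → u∈W ; 3F → p∈W ; 4F → z∈W }
            ; side     = λ { 0F → x~y ; 1F → y~u ; 2F → u~p ; 3F → p~z ; 4F → ~-sym x~z }
            ; distinct = λ { 0F → ≢-sym u≢x ; 1F → ≢-sym p≢y ; 2F → u≢z ; 3F → p≢x ; 4F → ≢-sym y≢z }
            }
          ; degree≡2 = λ { 0F → dx ; 1F → dy ; 2F → du ; 3F → dp ; 4F → dz }
          }
          where
          p∈ = ∈-remove⁻ p∈W″
          p≢x = proj₂ p∈
          p∈W-y-z = proj₁ p∈
          p≢z = proj₂ (∈-remove⁻ p∈W-y-z)
          p∈W-y = proj₁ (∈-remove⁻ p∈W-y-z)
          p≢y = proj₂ (∈-remove⁻ p∈W-y)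
          p∈W = proj₁ (∈-remove⁻ p∈W-y)
          u≢z = proj₂ (∈-remove⁻ (proj₁ (∈-remove⁻ u∈W″)))
          p≁y : ¬ p ~ y
          p≁y p~y = triangle-free y~u (~-sym p~y) u~p
          -- The degree of `p` dropped below 2 in the fork; neither `x` nor `y` is adjacent to `p`,
          -- so the lost edge went to `z`.
          p~z : p ~ z
          p~z with p ~? z
          ... | yes p~z = p~z
          ... | no p≁z = contradiction (≤-trans (min p∈W) (≤-trans (≤-reflexive
            (degree-quiet W⊆W₀ W≤M x∈W y∈W z∈W y≢z x~y x~z dx p∈W″ p≁y p≁z)) dp″)) (<⇒≱ ≤-refl)
          z∈W-y : z ∈ W ∖ y
          z∈W-y = ∈-remove⁺ z∈W (≢-sym y≢z)
          x∈W-y-z : x ∈ W ∖ y ∖ z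
          x∈W-y-z = ∈-remove⁺ (∈-remove⁺ x∈W (~⇒≢ x~y)) (~⇒≢ x~z)
          dp : degree W p ≡ 2
          dp = ≤-antisym (subst (_≤ 2) (sym (trans (degree-≁ y∈W p≁y) (trans (degree-~ z∈W-y p~z) (cong suc
                 (degree-≁ x∈W-y-z (w≁x W⊆W₀ W≤M x∈W y∈W z∈W y≢z x~y x~z dx p∈W″)))))) (s≤s dp″)) (min p∈W)
        analyse : ∀ d → degree W″ u ≡ d → Good 1 W ⊎ Pentagon W
        analyse zero eq = inj₁ (good-step⁰ R (reduced W≤M R))
          where R = F ⨾ᵣ isolated u∈W″ eq
        analyse (suc zero) eq with p , p∈W″ , u~p ← neighbour {W″} {u} (≤-reflexive (sym eq)) with 2 ≤? degree W″ p
        ... | yes 2≤p = inj₁ (good-step⁰ R (reduced W≤M R))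
          where R = F ⨾ᵣ pendant u∈W″ p∈W″ u~p eq 2≤p
        ... | no ¬2≤p = inj₂ (close p∈W″ u~p (≤-pred (≰⇒> ¬2≤p)))
        analyse (suc (suc d)) eq = contradiction (subst (_≤ 1) eq du″) λ { (s≤s ()) }

      good-or-pentagon-step : Nonempty W → Good 1 W ⊎ Pentagon W
      good-or-pentagon-step nonempty
        with x , x∈W , dx≤2 ← degenerate W (λ x∈ → x∈) nonempty
        with twoNeighbours {W} {x} (min x∈W)
      ... | record { a = y ; b = z ; a∈W = y∈W ; b∈W = z∈W ; a≢b = y≢z ; v~a = x~y ; v~b = x~z } =
        split (3 ≤? degree W y) (3 ≤? degree W z)
        where
        dx = ≤-antisym dx≤2 (min x∈W)
        low : ∀ {w} → w ∈ W → ¬ 3 ≤ degree W w → degree W w ≡ 2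
        low w∈W ¬3≤w = ≤-antisym (≤-pred (≰⇒> ¬3≤w)) (min w∈W)
        split : Dec (3 ≤ degree W y) → Dec (3 ≤ degree W z) → Good 1 W ⊎ Pentagon W
        -- Six edges are one more than a fork needs; this allows `k` to drop by one, which is the
        -- spare unit.
        split (yes 3≤y) (yes 3≤z) = inj₁ (good-step⁻ R (slack {W} (at-least R)) (reduced W≤M R))
          where R = fork x∈W y∈W z∈W y≢z x~y x~z dx 3≤y 3≤z
        split (yes 3≤y) (no ¬3≤z) = unbalanced x∈W z∈W y∈W (≢-sym y≢z) x~z x~y dx (low z∈W ¬3≤z) 3≤y
        split (no ¬3≤y) (yes 3≤z) = unbalanced x∈W y∈W z∈W y≢z x~y x~z dx (low y∈W ¬3≤y) 3≤z
        split (no ¬3≤y) (no ¬3≤z) = balanced x∈W y∈W z∈W y≢z x~y x~z dx (low y∈W ¬3≤y) (low z∈W ¬3≤z)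

    good-or-pentagon : ∀ N → GoodOrPentagon N
    good-or-pentagon (suc N) W (s≤s W≤N) W≤M W⊆W₀ degenerate nonempty
      with any? (λ x → (x ∈? W) ×-dec (degree W x ≤? 1))
    ... | yes (x , x∈W , d≤1) = inj₁ (good-leaf W≤M x∈W d≤1)
    ... | no ¬leaf = good-or-pentagon-step (good-or-pentagon N) W≤N W≤M W⊆W₀ degenerate
      (λ {x} x∈W → ≰⇒> λ d≤1 → ¬leaf (x , x∈W , d≤1)) nonempty

-- Minimum degree three and the main induction.

module Induction {n : ℕ} (G : Graph n)
  (sparse : ∀ U → 3 ≤ ∣ U ∣ → 3 * Neighbours.degreeSum G U + 16 ≤ 10 * ∣ U ∣) where

  open Neighbours G
  open Sparse G sparse
  open Pentagons G sparse

  record Separation (W S : Subset n) : Set where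
    constructor separation
    field
      within    : S ⊆ W
      inhabited : Nonempty S
      proper    : Nonempty (W ∩ ∁ S)
      closed    : ∀ x y → x ∈ S → y ∈ W → x ~ y → y ∈ S

  separation? : ∀ W S → Dec (Separation W S)
  separation? W S = map′ pack unpack
    ((S ⊆? W) ×-dec nonempty? S ×-dec nonempty? (W ∩ ∁ S) ×-dec
     all? λ x → all? λ y → (x ∈? S) →-dec (y ∈? W) →-dec (x ~? y) →-dec (y ∈? S))
    where
    Fields : Set
    Fields = S ⊆ W × Nonempty S × Nonempty (W ∩ ∁ S) × (∀ x y → x ∈ S → y ∈ W → x ~ y → y ∈ S)
    pack : Fields → Separation W S
    pack (p , q , r , s) = separation p q r s
    unpack : Separation W S → Fields
    unpack (separation p q r s) = p , q , r , s

  -- Both bounds are additive, and the union of the two independent sets is independent because no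
  -- edge joins the two sides.
  good-separated : ∀ {W S} → Separation W S → Good 0 S → Good 0 (W ∩ ∁ S) → Good 0 W
  good-separated {W} {S} sep (good k m I edges size) (good k′ m′ I′ edges′ size′) = good (k + k′) (m + m′)
    (join within T⊆W apart I I′)
    (subst (λ w → 8 * w ≤ degreeSum W + 14 * (m + m′) + 2 * (k + k′)) (sym (∣∣-split within))
      (lin (8 * (∣ S ∣ + ∣ T ∣)) _ 0 (+-mono-≤ (+-mono-≤ edges edges′) superadditive)
        (edge-id ∣ S ∣ ∣ T ∣ (degreeSum W) (degreeSum S) (degreeSum T) m m′ k k′)))
    (subst (λ w → w + (k + k′) + 0 ≤ 3 * (m + m′)) (sym (∣∣-split within))
      (lin (∣ S ∣ + ∣ T ∣ + (k + k′) + 0) _ 0 (+-mono-≤ size size′) (size-id ∣ S ∣ ∣ T ∣ m m′ k k′)))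
    where
    open Separation sep
    T : Subset n
    T = W ∩ ∁ S
    T⊆W : T ⊆ W
    T⊆W = p∩q⊆p W (∁ S)
    superadditive : degreeSum S + degreeSum T ≤ degreeSum W
    superadditive = subst (degreeSum S + degreeSum T ≤_) (sym (weight-split (degree W) within))
      (+-mono-≤ (weight-mono {W = S} λ {x} _ → degree-⊆ {S} x within) (weight-mono {W = T} λ {x} _ → degree-⊆ {T} x T⊆W))
    apart : ∀ {x y} → x ∈ S → y ∈ T → x ≢ y × ¬ x ~ y
    apart {x} {y} x∈S y∈T with y∈W , y∈∁S ← x∈p∩q⁻ W (∁ S) y∈T =
      (λ { refl → x∈∁p⇒x∉p y∈∁S x∈S }) , λ x~y → x∈∁p⇒x∉p y∈∁S (closed x y x∈S y∈W x~y)
    edge-id : ∀ s t e f g m m′ k k′ →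
              8 * (s + t) + 0 + (f + 14 * m + 2 * k + (g + 14 * m′ + 2 * k′) + e) ≡
              e + 14 * (m + m′) + 2 * (k + k′) + (8 * s + 8 * t + (f + g))
    edge-id = solve-∀
    size-id : ∀ s t m m′ k k′ → s + t + (k + k′) + 0 + 0 + (3 * m + 3 * m′) ≡ 3 * (m + m′) + (s + k + 0 + (t + k′ + 0))
    size-id = solve-∀

  -- Sparsity keeps the average degree below 10/3.
  degree≤3-exists : ∀ {W} → Nonempty W → ∃ λ v → v ∈ W × degree W v ≤ 3
  degree≤3-exists {W} (x , x∈W) with any? (λ v → (v ∈? W) ×-dec (degree W v ≤? 3))
  ... | yes found = found
  ... | no ¬low = contradiction
    (lin (16 + 2 * ∣ W ∣) 0 0 (+-mono-≤ (sparse W 3≤W) (*-monoʳ-≤ 3 4W≤)) (id ∣ W ∣ (degreeSum W))) λ ()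
    where
    high : ∀ {v} → v ∈ W → 4 ≤ degree W v
    high {v} v∈W = ≰⇒> λ d≤3 → ¬low (v , v∈W , d≤3)
    3≤W : 3 ≤ ∣ W ∣
    3≤W = ≤-trans (n≤1+n 3) (≤-trans (high x∈W) (degree≤∣∣ W x))
    4W≤ : 4 * ∣ W ∣ ≤ degreeSum W
    4W≤ = subst (_≤ degreeSum W) (weight-const W 4) (weight-mono {W = W} high)
    id : ∀ w e → 16 + 2 * w + 0 + (10 * w + 3 * e) ≡ 0 + (3 * e + 16 + 3 * (4 * w))
    id = solve-∀

  filter : ∀ {P : Fin n → Set} → (∀ x → Dec (P x)) → Subset n
  filter P? = tabulate (λ x → does (P? x))

  ∈-filter⁺ : ∀ {P : Fin n → Set} (P? : ∀ x → Dec (P x)) {x} → P x → x ∈ filter P?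
  ∈-filter⁺ P? {x} Px = lookup⇒[]= x _ (trans (lookup∘tabulate _ x) (dec-true (P? x) Px))

  ∈-filter⁻ : ∀ {P : Fin n → Set} (P? : ∀ x → Dec (P x)) {x} → x ∈ filter P? → P x
  ∈-filter⁻ P? {x} x∈ = holds (P? x) (trans (sym (lookup∘tabulate _ x)) ([]=⇒lookup x∈))
    where
    holds : ∀ {A : Set} (A? : Dec A) → does A? ≡ true → A
    holds (yes a) _ = a

  module _ (M : ℕ) (smaller : ∀ U → ∣ U ∣ < M → Good 0 U) where

    open Reducing G sparse M smaller

    -- A claw removes nine edges, 4 * 4 = 9 + 7, but four vertices for one, so the size bound is
    -- short by one. On a 4-cycle `x a y b` the opposite vertex `y` has lost `a` and `b`, and the
    -- leaf step at `y` makes up the unit. Without 4-cycles `good-or-pentagon` supplies it.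
    good-cubic : ∀ {W} → ∣ W ∣ ≤ M → Nonempty W → (∀ S → ¬ Separation W S) →
                 (∀ {x} → x ∈ W → degree W x ≡ 3) → Good 0 W
    good-cubic {W} W≤M (v , v∈W) connected cubic with any? (λ x → any? λ y → any? λ a → any? λ b →
        (x ∈? W) ×-dec (y ∈? W) ×-dec (a ∈? W) ×-dec (b ∈? W) ×-dec ¬? (x Fin.≟ y) ×-dec ¬? (a Fin.≟ b) ×-dec
        (x ~? a) ×-dec (x ~? b) ×-dec (y ~? a) ×-dec (y ~? b))
    ... | yes (x , y , a , b , x∈W , y∈W , a∈W , b∈W , x≢y , a≢b , x~a , x~b , y~a , y~b) =
      recover (leaf y∈W′ (≤-trans (≤-trans (degree-remove (W ∖ a ∖ b ∖ c) x y) (degree-remove (W ∖ a ∖ b) c y))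
                 (≤-reflexive (degree-pred b∈W-a y~b (degree-pred a∈W y~a (cubic y∈W))))))
      where
      third = thirdNeighbour a∈W b∈W a≢b x~a x~b (cubic x∈W)
      c = proj₁ third
      N : ThreeNeighbours W x
      N = record { a∈W = a∈W ; b∈W = b∈W ; c∈W = proj₁ (proj₂ third) ; a≢b = a≢b
                 ; a≢c = proj₁ (proj₂ (proj₂ third)) ; b≢c = proj₁ (proj₂ (proj₂ (proj₂ third)))
                 ; v~a = x~a ; v~b = x~b ; v~c = proj₂ (proj₂ (proj₂ (proj₂ third))) }
      open ThreeNeighbours N using (c∈W) renaming (v~c to x~c)
      b∈W-a : b ∈ W ∖ a
      b∈W-a = ∈-remove⁺ b∈W (≢-sym a≢b)
      y∈W′ : y ∈ W ∖ a ∖ b ∖ c ∖ x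
      y∈W′ = ∈-remove⁺ (∈-remove⁺ (∈-remove⁺ (∈-remove⁺ y∈W (~⇒≢ y~a)) (~⇒≢ y~b))
               λ { refl → triangle-free x~c x~a y~a }) (≢-sym x≢y)
      R : Reduction W (W ∖ a ∖ b ∖ c ∖ x) 4 9 1
      R = claw x∈W N (cubic x∈W) (≤-reflexive (sym (cubic a∈W))) (≤-reflexive (sym (cubic b∈W))) (≤-reflexive (sym (cubic c∈W)))
      recover : Leaf (W ∖ a ∖ b ∖ c ∖ x) y → Good 0 W
      recover (leaf₀ L)   = good-step⁰ (R ⨾ᵣ L) (reduced W≤M (R ⨾ᵣ L))
      recover (leaf₁ _ L) = good-step⁰ (R ⨾ᵣ L) (reduced W≤M (R ⨾ᵣ L))
    ... | no ¬C₄
      with a , a∈W , v~a ← neighbour {W} {v} (subst (1 ≤_) (sym (cubic v∈W)) (s≤s z≤n))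
      with b , b∈W , b≢a , v~b ← neighbour-other {W} {v} a∈W v~a (subst (2 ≤_) (sym (cubic v∈W)) (s≤s (s≤s z≤n)))
      with c , c∈W , a≢c , b≢c , v~c ← thirdNeighbour a∈W b∈W (≢-sym b≢a) v~a v~b (cubic v∈W)
      with u , u∈W , u≢v , a~u ← neighbour-other {W} {a} v∈W (~-sym v~a) (subst (2 ≤_) (sym (cubic a∈W)) (s≤s (s≤s z≤n))) =
      conclude (good-or-pentagon free (suc ∣ W′ ∣) W′ ≤-refl W′≤M (shrinks (peels R)) degenerate
        (u , ∈-remove⁺ (∈-remove⁺ (∈-remove⁺ (∈-remove⁺ u∈W (≢-sym (~⇒≢ a~u)))
               λ { refl → triangle-free v~a v~b a~u }) λ { refl → triangle-free v~a v~c a~u }) u≢v))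
      where
      free : FourCycleFree W
      free p q r s t w xa xb ya yb = ¬C₄ (_ , _ , _ , _ , p , q , r , s , t , w , xa , xb , ya , yb)
      a≢b = ≢-sym b≢a
      W′ : Subset n
      W′ = W ∖ a ∖ b ∖ c ∖ v
      N : ThreeNeighbours W v
      N = record { a∈W = a∈W ; b∈W = b∈W ; c∈W = c∈W ; a≢b = a≢b ; a≢c = a≢c ; b≢c = b≢c ; v~a = v~a ; v~b = v~b ; v~c = v~c }
      R : Reduction W W′ 4 9 1
      R = claw v∈W N (cubic v∈W) (≤-reflexive (sym (cubic a∈W))) (≤-reflexive (sym (cubic b∈W))) (≤-reflexive (sym (cubic c∈W)))
      W′≤M : ∣ W′ ∣ ≤ M
      W′≤M = ≤-trans (m≤n+m _ 4) (≤-trans (≤-reflexive (sym (removed (peels R)))) W≤M)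
      -- A nonempty subset with all degrees at least 3 would contain every neighbour of its members,
      -- as `W` is cubic, and so would be separated from `v`.
      degenerate : Degenerate free W′
      degenerate S S⊆W′ (s , s∈S) with any? (λ x → (x ∈? S) ×-dec (degree S x ≤? 2))
      ... | yes found = found
      ... | no ¬low = contradiction (separation S⊆W (s , s∈S) (v , x∈p∩q⁺ (v∈W , x∉p⇒x∈∁p λ v∈S → ∉-remove (S⊆W′ v∈S))) closed)
                        (connected S)
        where
        S⊆W : S ⊆ W
        S⊆W = shrinks (peels R) ∘ S⊆W′
        closed : ∀ x y → x ∈ S → y ∈ W → x ~ y → y ∈ S
        closed x y x∈S y∈W x~y with y ∈? S
        ... | yes y∈S = y∈S
        ... | no y∉S = contradiction (x , x∈S , (begin
          degree S x        ≤⟨ degree-⊆ {S} {W ∖ y} x (λ z∈S → ∈-remove⁺ (S⊆W z∈S) λ { refl → y∉S z∈S }) ⟩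
          degree (W ∖ y) x  ≡⟨ degree-pred y∈W x~y (cubic (S⊆W x∈S)) ⟩
          2                 ∎)) ¬low
          where open ≤-Reasoning
      -- Each pentagon vertex has degree 3 in `W` but 2 in `W′`, hence a neighbour among `a`, `b`,
      -- `c`; it cannot be `v`, whose degree these three exhaust. Two of the five vertices share
      -- such a neighbour, against `attached-once`.
      no-pentagon : ¬ Pentagon W′
      no-pentagon K = collide (pigeonhole (s≤s (s≤s (s≤s (s≤s z≤n)))) (proj₁ ∘ attachment))
        where
        open Pentagon K
        open Cycle₅ cycle using () renaming (c to vertex; c∈W to vertex∈W′)
        nb : Fin 3 → Fin n
        nb 0F = a
        nb 1F = b
        nb 2F = c
        nb∈W : ∀ t → nb t ∈ W
        nb∈W 0F = a∈W
        nb∈W 1F = b∈W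
        nb∈W 2F = c∈W
        c≢nb : ∀ k t → vertex k ≢ nb t
        c≢nb k t
          with ∈abc , _ ← ∈-remove⁻ (vertex∈W′ k)
          with ∈ab , ≢c ← ∈-remove⁻ ∈abc
          with ∈a , ≢b ← ∈-remove⁻ ∈ab
          with _ , ≢a ← ∈-remove⁻ ∈a = avoid t ≢a ≢b ≢c
          where
          avoid : ∀ t → vertex k ≢ a → vertex k ≢ b → vertex k ≢ c → vertex k ≢ nb t
          avoid 0F ≢a _ _ = ≢a
          avoid 1F _ ≢b _ = ≢b
          avoid 2F _ _ ≢c = ≢c
        b∈ : b ∈ W ∖ a
        b∈ = ∈-remove⁺ b∈W b≢a
        c∈ : c ∈ W ∖ a ∖ b
        c∈ = ∈-remove⁺ (∈-remove⁺ (c∈W) (≢-sym a≢c)) (≢-sym b≢c)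
        v∈ : v ∈ W ∖ a ∖ b ∖ c
        v∈ = ∈-remove⁺ (∈-remove⁺ (∈-remove⁺ v∈W (~⇒≢ v~a)) (~⇒≢ v~b)) (~⇒≢ v~c)
        attachment : ∀ i → ∃ λ t → vertex i ~ nb t
        attachment i with any? (λ t → vertex i ~? nb t)
        ... | yes found = found
        ... | no ¬attached = contradiction (begin
          3                            ≡⟨ cubic (shrinks (peels R) (vertex∈W′ i)) ⟨
          degree W (vertex i)          ≡⟨ degree-≁ a∈W (λ p → ¬attached (0F , p)) ⟩
          degree (W ∖ a) (vertex i)    ≡⟨ degree-≁ b∈ (λ p → ¬attached (1F , p)) ⟩
          degree (W ∖ a ∖ b) (vertex i)      ≡⟨ degree-≁ c∈ (λ p → ¬attached (2F , p)) ⟩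
          degree (W ∖ a ∖ b ∖ c) (vertex i)  ≡⟨ degree-≁ v∈ (λ i~v → degree≡0⇒≁
                                                  (degree-pred c∈ v~c (degree-pred b∈ v~b (degree-pred a∈W v~a (cubic v∈W))))
                                                  (remove-⊆ (vertex∈W′ i)) (~-sym i~v)) ⟩
          degree W′ (vertex i)         ≡⟨ degree≡2 i ⟩
          2                            ∎) λ ()
          where open ≡-Reasoning
        collide : (∃₂ λ i j → i Fin.< j × proj₁ (attachment i) ≡ proj₁ (attachment j)) → ⊥
        collide (i , j , i<j , shared) = <⇒≢ i<j
          (attached-once free (weaken (shrinks (peels R)) cycle) (nb∈W t) (λ k → c≢nb k t) (proj₂ (attachment i))
            (subst (λ t → vertex j ~ nb t) (sym shared) (proj₂ (attachment j))))
          where t = proj₁ (attachment i)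
      conclude : Good 1 W′ ⊎ Pentagon W′ → Good 0 W
      conclude (inj₁ g) = good-step⁰ R g
      conclude (inj₂ K) = contradiction K no-pentagon

    good-mindegree≥3 : ∀ {W} → ∣ W ∣ ≤ M → Nonempty W → (∀ {x} → x ∈ W → 3 ≤ degree W x) → Good 0 W
    good-mindegree≥3 {W} W≤M nonempty min with anySubset? (separation? W)
    ... | yes (S , sep) = good-separated sep
      (smaller S (<-≤-trans (subst (∣ S ∣ <_) (sym split) (subst (_≤ ∣ S ∣ + ∣ W ∩ ∁ S ∣) (+-comm ∣ S ∣ 1) (+-monoʳ-≤ ∣ S ∣ (∣∣-nonempty proper)))) W≤M))
      (smaller (W ∩ ∁ S) (<-≤-trans (subst (∣ W ∩ ∁ S ∣ <_) (sym split) (+-monoˡ-≤ ∣ W ∩ ∁ S ∣ (∣∣-nonempty inhabited))) W≤M))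
      where
      open Separation sep
      split = ∣∣-split within
    ... | no ¬sep with any? (λ v → any? λ u → (v ∈? W) ×-dec (u ∈? W) ×-dec (v ~? u) ×-dec (degree W v ≟ 3) ×-dec (4 ≤? degree W u))
    ... | yes (v , a , v∈W , a∈W , v~a , deg , 4≤a)
      with b , b∈W , b≢a , v~b ← neighbour-other {W} {v} a∈W v~a (subst (2 ≤_) (sym deg) (s≤s (s≤s z≤n)))
      with c , c∈W , a≢c , b≢c , v~c ← thirdNeighbour a∈W b∈W (≢-sym b≢a) v~a v~b deg =
      -- The neighbour of degree at least 4 raises the loss to ten edges, 16 + 1 = 10 + 7; the unit
      -- gained lowers `k` and covers the deficit of the claw in the size bound.
      good-step⁻ R (slack₀ {W} (at-least R)) (reduced W≤M R)
      where
      R = claw v∈W (record { a∈W = a∈W ; b∈W = b∈W ; c∈W = c∈W ; a≢b = ≢-sym b≢a ; a≢c = a≢c ; b≢c = b≢c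
                           ; v~a = v~a ; v~b = v~b ; v~c = v~c }) deg 4≤a (min b∈W) (min c∈W)
    -- The vertices of degree 3 are now closed under adjacency, and there is at least one of them;
    -- since no separation exists, they are all of `W`.
    ... | no ¬mixed = good-cubic W≤M nonempty (λ S sep → ¬sep (S , sep)) cubic
      where
      cubic? : ∀ x → Dec (x ∈ W × degree W x ≡ 3)
      cubic? x = (x ∈? W) ×-dec (degree W x ≟ 3)
      S : Subset n
      S = filter cubic?
      closed : ∀ x y → x ∈ S → y ∈ W → x ~ y → y ∈ S
      closed x y x∈S y∈W x~y with x∈W , deg ← ∈-filter⁻ cubic? x∈S =
        ∈-filter⁺ cubic? (y∈W , ≤-antisym (≤-pred (≰⇒> λ 4≤y → ¬mixed (x , y , x∈W , y∈W , x~y , deg , 4≤y))) (min y∈W))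
      cubic : ∀ {x} → x ∈ W → degree W x ≡ 3
      cubic {x} x∈W with x ∈? S
      ... | yes x∈S = proj₂ (∈-filter⁻ cubic? x∈S)
      ... | no x∉S with v , v∈W , d≤3 ← degree≤3-exists nonempty = contradiction
        (S , separation (proj₁ ∘ ∈-filter⁻ cubic?) (v , ∈-filter⁺ cubic? (v∈W , ≤-antisym d≤3 (min v∈W)))
               (x , x∈p∩q⁺ (x∈W , x∉p⇒x∈∁p x∉S)) closed) ¬sep

    good-next : ∀ W → ∣ W ∣ ≤ M → Good 0 W
    good-next W W≤M with nonempty? W
    ... | no empty = good 0 0 (independent [] refl [] [])
      (subst (λ w → 8 * w ≤ degreeSum W + 0 + 0) (sym size) z≤n) (subst (λ w → w + 0 + 0 ≤ 0) (sym size) z≤n)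
      where
      size : ∣ W ∣ ≡ 0
      size = trans (cong ∣_∣ (Empty-unique empty)) (∣⊥∣≡0 n)
    ... | yes nonempty with any? (λ x → (x ∈? W) ×-dec (degree W x ≤? 1))
    ... | yes (x , x∈W , d≤1) = good-weaken (good-leaf W≤M x∈W d≤1)
    ... | no ¬leaf with any? (λ x → (x ∈? W) ×-dec (degree W x ≟ 2))
    ... | yes (x , x∈W , d≡2) = good-degree≡2 W≤M (λ {y} y∈W → ≰⇒> λ d≤1 → ¬leaf (y , y∈W , d≤1)) x∈W d≡2
    ... | no ¬2 = good-mindegree≥3 W≤M nonempty λ {y} y∈W →
      ≤∧≢⇒< (≰⇒> λ d≤1 → ¬leaf (y , y∈W , d≤1)) λ 2≡d → ¬2 (y , y∈W , sym 2≡d)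

  good-below : ∀ M U → ∣ U ∣ < M → Good 0 U
  good-below (suc M) U (s≤s U≤M) = good-next M (good-below M) U U≤M

  all-good : ∀ W → Good 0 W
  all-good W = good-below (suc ∣ W ∣) W ≤-refl

-- Double counting of edges.

weight-comm : ∀ {m n} (V : Subset m) (W : Subset n) (f : Fin m → Fin n → ℕ) →
              weight V (λ i → weight W (f i)) ≡ weight W (λ j → weight V (λ i → f i j))
weight-comm []            W f = sym (weight-const W 0)
weight-comm (inside  ∷ V) W f =
  trans (cong (weight W (f zero) +_) (weight-comm V W (f ∘ suc))) (sym (weight-+ W (f zero) _))
weight-comm (outside ∷ V) W f = weight-comm V W (f ∘ suc)

weight-restrict : ∀ (W : Subset n) f → weight W f ≡ weight ⊤ (λ i → if lookup W i then f i else 0)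
weight-restrict []            f = refl
weight-restrict (inside  ∷ W) f = cong (f zero +_) (weight-restrict W (f ∘ suc))
weight-restrict (outside ∷ W) f = weight-restrict W (f ∘ suc)

sum-allFin : ∀ (f : Fin n → ℕ) → sum (map f (allFin n)) ≡ weight ⊤ f
sum-allFin f = trans (cong sum (map-tabulate (λ i → i) f)) (go f)
  where
  go : ∀ {n} (f : Fin n → ℕ) → sum (List.tabulate f) ≡ weight ⊤ f
  go {zero}  f = refl
  go {suc n} f = cong (f zero +_) (go (f ∘ suc))

-- `countEdges` sees a pair only when `j < i`. Each entry is split by the order of its indices, the
-- diagonal being zero, and exchanging the sums turns the upper half into the lower one.
handshake : (E : Fin n → Fin n → Bool) → (∀ i j → E i j ≡ E j i) → (∀ i → E i i ≡ false) →
            weight ⊤ (λ i → weight ⊤ λ j → ⟦ E i j ⟧) ≡ 2 * countEdges E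
handshake {n} E E-sym E-irrefl = begin
  weight ⊤ (λ i → weight ⊤ λ j → ⟦ E i j ⟧)
    ≡⟨ weight-cong ⊤ (λ {i} _ → weight-cong ⊤ λ {j} _ → halves i j) ⟩
  weight ⊤ (λ i → weight ⊤ λ j → below i j + below j i)
    ≡⟨ weight-cong ⊤ (λ {i} _ → weight-+ ⊤ (below i) (λ j → below j i)) ⟩
  weight ⊤ (λ i → weight ⊤ (below i) + weight ⊤ λ j → below j i)
    ≡⟨ weight-+ (⊤ {n}) (λ i → weight ⊤ (below i)) (λ i → weight ⊤ λ j → below j i) ⟩
  total + weight ⊤ (λ i → weight ⊤ λ j → below j i)
    ≡⟨ cong (total +_) (weight-comm (⊤ {n}) (⊤ {n}) λ i j → below j i) ⟩
  total + total
    ≡⟨ cong (total +_) (+-identityʳ total) ⟨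
  2 * total
    ≡⟨ cong (2 *_) (weight-cong (⊤ {n}) λ {i} _ → sum-allFin (below i)) ⟨
  2 * weight ⊤ (λ i → sum (map (below i) (allFin n)))
    ≡⟨ cong (2 *_) (sum-allFin {n} λ i → sum (map (below i) (allFin n))) ⟨
  2 * countEdges E ∎
  where
  open ≡-Reasoning
  below : Fin n → Fin n → ℕ
  below i j = ⟦ ⌊ j Fin.<? i ⌋ ∧ E i j ⟧
  total = weight ⊤ (λ i → weight ⊤ (below i))
  halves : ∀ i j → ⟦ E i j ⟧ ≡ below i j + below j i
  halves i j with j Fin.<? i | i Fin.<? j | <-cmp i j
  ... | yes j<i | yes i<j | _            = contradiction i<j (<-asym j<i)
  ... | yes j<i | no i≮j  | _            = sym (+-identityʳ _)
  ... | no j≮i  | yes i<j | _            = cong ⟦_⟧ (E-sym i j)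
  ... | no j≮i  | no i≮j  | tri< i<j _ _ = contradiction i<j i≮j
  ... | no j≮i  | no i≮j  | tri≈ _ refl _ = cong ⟦_⟧ (E-irrefl i)
  ... | no j≮i  | no i≮j  | tri> _ _ j<i = contradiction j<i j≮i

-- Induced subgraphs and independent subsets.

module _ {n : ℕ} (G : Graph n) where

  open Neighbours G

  induced : Subset n → Subgraph G
  induced U = record
    { verts    = U
    ; edge     = λ i j → lookup U i ∧ lookup U j ∧ adj G i j
    ; edge-sym = symmetric
    ; edge-sub = within
    }
    where
    symmetric : ∀ i j → lookup U i ∧ lookup U j ∧ adj G i j ≡ lookup U j ∧ lookup U i ∧ adj G j i
    symmetric i j with lookup U i | lookup U j
    ... | true  | true  = adj-sym G i j
    ... | true  | false = refl
    ... | false | true  = refl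
    ... | false | false = refl
    within : ∀ i j → lookup U i ∧ lookup U j ∧ adj G i j ≡ true → i ∈ U × j ∈ U × i ~ j
    within i j eq with lookup U i in i∈ | lookup U j in j∈
    ... | true | true = lookup⇒[]= i U i∈ , lookup⇒[]= j U j∈ , eq

  degreeSum-induced : ∀ U → degreeSum U ≡ 2 * ecount (induced U)
  degreeSum-induced U = begin
    degreeSum U
      ≡⟨ weight-restrict U (degree U) ⟩
    weight ⊤ (λ i → if lookup U i then degree U i else 0)
      ≡⟨ weight-cong ⊤ (λ {i} _ → row i) ⟩
    weight ⊤ (λ i → weight ⊤ λ j → ⟦ edge (induced U) i j ⟧)
      ≡⟨ handshake (edge (induced U)) (edge-sym (induced U)) irreflexive ⟩
    2 * ecount (induced U) ∎
    where
    open ≡-Reasoning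
    irreflexive : ∀ i → lookup U i ∧ lookup U i ∧ adj G i i ≡ false
    irreflexive i rewrite adj-irrefl G i | ∧-zeroʳ (lookup U i) = ∧-zeroʳ (lookup U i)
    entry : ∀ u b → (if u then ⟦ b ⟧ else 0) ≡ ⟦ u ∧ b ⟧
    entry true  b = refl
    entry false b = refl
    row : ∀ i → (if lookup U i then degree U i else 0) ≡ weight ⊤ (λ j → ⟦ lookup U i ∧ lookup U j ∧ adj G i j ⟧)
    row i with lookup U i
    ... | true  = trans (weight-restrict U _) (weight-cong (⊤ {n}) λ {j} _ → entry (lookup U j) (adj G i j))
    ... | false = sym (weight-const {n} ⊤ 0)

  -- The last component says that `S` contains only list members, in the form in which the induction
  -- uses it: applied to `new`, it shows that `x` lies outside `S` and has no neighbour there, so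
  -- the size grows and independence persists.
  independentSubset : ∀ {xs} → AllPairs (λ x y → x ≢ y × ¬ x ~ y) xs →
                      ∃ λ S → length xs ≤ ∣ S ∣ × Independent G S × (∀ {P : Fin n → Set} → All P xs → ∀ {x} → x ∈ S → P x)
  independentSubset [] = Subset.⊥ , z≤n , (λ i j i∈ _ → contradiction i∈ ∉⊥) , λ _ x∈ → contradiction x∈ ∉⊥
  independentSubset {x ∷ xs} (new ∷ pairs) with S , size , indep , all ← independentSubset pairs =
    ⁅ x ⁆ ∪ S , size′ , indep′ , all′
    where
    size′ : suc (length xs) ≤ ∣ ⁅ x ⁆ ∪ S ∣
    size′ = subst (suc (length xs) ≤_) (sym (∣∣-remove {W = ⁅ x ⁆ ∪ S} (x∈p∪q⁺ (inj₁ (x∈⁅x⁆ x)))))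
      (s≤s (≤-trans size (p⊆q⇒∣p∣≤∣q∣ {p = S} {q = ⁅ x ⁆ ∪ S ∖ x} λ y∈S → ∈-remove⁺ (x∈p∪q⁺ (inj₂ y∈S)) (≢-sym (proj₁ (all new y∈S))))))
    non-adjacent : ∀ {y} → y ∈ S → adj G x y ≡ false
    non-adjacent y∈S = ¬-not (proj₂ (all new y∈S))
    indep′ : Independent G (⁅ x ⁆ ∪ S)
    indep′ i j i∈ j∈ with x∈p∪q⁻ ⁅ x ⁆ S i∈ | x∈p∪q⁻ ⁅ x ⁆ S j∈
    ... | inj₂ i∈S | inj₂ j∈S = indep i j i∈S j∈S
    ... | inj₁ i≡x | inj₂ j∈S rewrite x∈⁅y⁆⇒x≡y x i≡x = non-adjacent j∈S
    ... | inj₂ i∈S | inj₁ j≡x rewrite x∈⁅y⁆⇒x≡y x j≡x = trans (adj-sym G i x) (non-adjacent i∈S)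
    ... | inj₁ i≡x | inj₁ j≡x rewrite x∈⁅y⁆⇒x≡y x i≡x | x∈⁅y⁆⇒x≡y x j≡x = adj-irrefl G x
    all′ : ∀ {P : Fin n → Set} → All P (x ∷ xs) → ∀ {y} → y ∈ ⁅ x ⁆ ∪ S → P y
    all′ {P} (px ∷ pxs) y∈ with x∈p∪q⁻ ⁅ x ⁆ S y∈
    ... | inj₁ y≡x = subst P (sym (x∈⁅y⁆⇒x≡y x y≡x)) px
    ... | inj₂ y∈S = all pxs y∈S

-- Rational estimates and the conclusion.

open import Data.Integer as ℤ using (+_)
import Data.Integer.Properties as ℤ
open import Data.Rational as ℚ using (_-_)
import Data.Rational.Properties as ℚ
open import Data.Rational.Unnormalised as ℚᵘ using (mkℚᵘ; _≃_; *≤*)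
import Data.Rational.Unnormalised.Properties as ℚᵘ

p≤r+q⇒p-q≤r : ∀ {p q r} → p ℚ.≤ r ℚ.+ q → p - q ℚ.≤ r
p≤r+q⇒p-q≤r {p} {q} {r} p≤r+q = subst (p - q ℚ.≤_)
  (trans (ℚ.+-assoc r q (ℚ.- q)) (trans (cong (r ℚ.+_) (ℚ.+-inverseʳ q)) (ℚ.+-identityʳ r)))
  (ℚ.+-monoˡ-≤ (ℚ.- q) p≤r+q)

-- Once 1/(b+1) is moved to the right, the hypothesis is the cross-multiplied form of 5/3 ≤ e/(w+1)
-- + 1/(b+1), which is how unnormalised rationals are compared.
÷-bound : ∀ b w e → 5 * (suc w * suc b) ≤ (e * suc b + 1 * suc w) * 3 →
          ((+ 5) ÷ 3) - ((+ 1) ÷ suc b) ℚ.≤ (+ e) ÷ suc w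
÷-bound b w e bound = p≤r+q⇒p-q≤r {(+ 5) ÷ 3} {(+ 1) ÷ suc b} {(+ e) ÷ suc w} (ℚ.toℚᵘ-cancel-≤
  (ℚᵘ.≤-respʳ-≃ {mkℚᵘ (+ 5) 2} (ℚᵘ.≃-sym sum≃) (*≤* (subst₂ ℤ._≤_ (ℤ.pos-* 5 (suc w * suc b)) numerator (ℤ.+≤+ bound)))))
  where
  sum≃ : ℚ.toℚᵘ (((+ e) ÷ suc w) ℚ.+ ((+ 1) ÷ suc b)) ≃ mkℚᵘ (+ e) w ℚᵘ.+ mkℚᵘ (+ 1) b
  sum≃ = ℚᵘ.≃-trans (ℚ.toℚᵘ-homo-+ ((+ e) ÷ suc w) ((+ 1) ÷ suc b))
    (ℚᵘ.+-cong (ℚ.toℚᵘ-fromℚᵘ (mkℚᵘ (+ e) w)) (ℚ.toℚᵘ-fromℚᵘ (mkℚᵘ (+ 1) b)))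
  numerator : + ((e * suc b + 1 * suc w) * 3) ≡ (+ e ℤ.* + suc b ℤ.+ + 1 ℤ.* + suc w) ℤ.* + 3
  numerator = trans (ℤ.pos-* (e * suc b + 1 * suc w) 3)
    (cong (ℤ._* + 3) (cong₂ ℤ._+_ (ℤ.pos-* e (suc b)) (ℤ.pos-* 1 (suc w))))

-- Since `e` is a successor, the integer e - 1 computes to a natural number, at least `d`, and
-- `÷-bound` applies.
ratio-bound : ∀ v {e b w d} → v ∸ 2 ≡ suc w → suc d ≤ e → 5 * (suc w * suc b) ≤ (d * suc b + 1 * suc w) * 3 →
              ((+ 5) ÷ 3) - ((+ 1) ÷ suc b) ℚ.≤ (+ e ℤ.- + 1) ÷ (v ∸ 2)
ratio-bound v {suc e} {b} {w} v≡ (s≤s d≤e) bound rewrite v≡ = ÷-bound b w e (≤-trans bound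
  (*-monoˡ-≤ 3 (+-monoˡ-≤ (1 * suc w) (*-monoˡ-≤ (suc b) d≤e))))

dense-ratio : ∀ {v e} b → 3 ≤ v → 5 * v < 3 * e + 8 →
              ((+ 5) ÷ 3) - ((+ 1) ÷ suc b) ℚ.≤ (+ e ℤ.- + 1) ÷ (v ∸ 2)
-- No edges at all is impossible here, as 5v ≥ 15 exceeds 8.
dense-ratio {suc (suc (suc w))} {zero} b (s≤s (s≤s (s≤s _))) dense = contradiction
  (lin (8 + 5 * w) 0 0 dense (id w)) λ ()
  where
  id : ∀ w → 8 + 5 * w + 0 + 8 ≡ 0 + suc (5 * (3 + w))
  id = solve-∀
dense-ratio {suc (suc (suc w))} {suc e} b (s≤s (s≤s (s≤s _))) dense = ratio-bound (3 + w) {suc e} {b} {w} {e} refl ≤-refl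
  -- The ratio already reaches 5/3; the slack `3 * suc w` is the contribution of 1/(b+1).
  (lin (5 * (suc w * suc b)) ((e * suc b + 1 * suc w) * 3) (3 * suc w) (*-monoˡ-≤ (suc b) dense) (id b w e))
  where
  id : ∀ b w e → 5 * (suc w * suc b) + 3 * suc w + (3 * suc e + 8) * suc b ≡
                 (e * suc b + 1 * suc w) * 3 + suc (5 * (3 + w)) * suc b
  id = solve-∀

theorem3p2 : (r : ℕ) → 3 ≤ r → M≥ (3 * r ∸ 4) r (((+ 5) ÷ 3) - ((+ 1) ÷ (r ∸ 2)))
-- With r = 3 + b the graph has 5 + 3b vertices, independent sets have at most 2 + b, and the
-- subtracted term is 1/(b+1).
theorem3p2 (suc (suc (suc b))) (s≤s (s≤s (s≤s _))) G α≤
  with anySubset? (λ U → (3 ≤? ∣ U ∣) ×-dec ¬? (3 * Neighbours.degreeSum G U + 16 ≤? 10 * ∣ U ∣))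
... | yes (U , 3≤U , dense) = induced G U , 3≤U , dense-ratio {e = e} b 3≤U
  (*-cancelˡ-< 2 (5 * ∣ U ∣) (3 * e + 8) (subst₂ _<_ (*-assoc 2 5 ∣ U ∣) double (≰⇒> dense)))
  where
  e = ecount (induced G U)
  id : ∀ e → 3 * (2 * e) + 16 ≡ 2 * (3 * e + 8)
  id = solve-∀
  double : 3 * Neighbours.degreeSum G U + 16 ≡ 2 * (3 * e + 8)
  double = trans (cong (λ d → 3 * d + 16) (degreeSum-induced G U)) (id e)
... | no ¬dense = conclude (all-good ⊤)
  where
  sparse : ∀ U → 3 ≤ ∣ U ∣ → 3 * Neighbours.degreeSum G U + 16 ≤ 10 * ∣ U ∣
  sparse U 3≤U = decidable-stable (_ ≤? _) λ dense → ¬dense (U , 3≤U , dense)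
  open Neighbours G
  open Induction G sparse
  e = ecount (induced G ⊤)
  order : ∣ ⊤ {3 * (3 + b) ∸ 4} ∣ ≡ 5 + 3 * b
  order = trans (∣⊤∣≡n _) (trans (cong (_∸ 4) (id b)) (m+n∸m≡n 4 (5 + 3 * b)))
    where
    id : ∀ b → 3 * (3 + b) ≡ 4 + (5 + 3 * b)
    id = solve-∀
  conclude : Good 0 ⊤ → m₂≥ G (((+ 5) ÷ 3) - ((+ 1) ÷ suc b))
  -- The whole graph serves as the subgraph. Its ratio is at least (4 + 5b)/(3 + 3b), which exceeds
  -- the target by 2/(3(b+1)); this is the slack `6 * suc b`.
  conclude (good k m (independent xs size _ pairs) edges bound) =
    induced G ⊤ , subst (3 ≤_) (sym order) (m≤m+n 3 _) ,
    ratio-bound ∣ ⊤ {3 * (3 + b) ∸ 4} ∣ {e} (cong (_∸ 2) order) e≥ (≤-trans (m≤m+n _ (6 * suc b)) (≤-reflexive (id₃ b)))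
    where
    m≤ : m ≤ 2 + b
    m≤ with S , xs≤S , indep , _ ← independentSubset G pairs = subst (_≤ 2 + b) size (≤-trans xs≤S (α≤ S indep))
    -- From 5 + 3b + k ≤ 3m ≤ 6 + 3b.
    k≤1 : k ≤ 1
    k≤1 = lin k 1 0 (+-mono-≤ (subst (λ v → v + k + 0 ≤ 3 * m) order bound) (*-monoʳ-≤ 3 m≤)) (id₁ b k m)
      where
      id₁ : ∀ b k m → k + 0 + (3 * m + 3 * (2 + b)) ≡ 1 + (5 + 3 * b + k + 0 + 3 * m)
      id₁ = solve-∀
    -- From 8(5 + 3b) ≤ 2e + 14(2 + b) + 2, that is, e ≥ 5 + 5b.
    e≥ : suc (4 + 5 * b) ≤ e
    e≥ = *-cancelˡ-≤ 2 (lin (2 * suc (4 + 5 * b)) (2 * e) 0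
      (+-mono-≤ (+-mono-≤ (subst₂ (λ v d → 8 * v ≤ d + 14 * m + 2 * k) order (degreeSum-induced G ⊤) edges)
        (*-monoʳ-≤ 14 m≤)) (*-monoʳ-≤ 2 k≤1)) (id₂ b m k e))
      where
      id₂ : ∀ b m k e → 2 * suc (4 + 5 * b) + 0 + (2 * e + 14 * m + 2 * k + 14 * (2 + b) + 2 * 1) ≡
                        2 * e + (8 * (5 + 3 * b) + 14 * m + 2 * k)
      id₂ = solve-∀
    id₃ : ∀ b → 5 * (suc (2 + 3 * b) * suc b) + 6 * suc b ≡ ((4 + 5 * b) * suc b + 1 * suc (2 + 3 * b)) * 3
    id₃ = solve-∀
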